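{- As formal power series in $q$ (equivalently, for complex $q$ with $|q|<1$), $$\sum_{n\ge 0}\frac{q^{n^2}}{(q;q)_{2n}}=\frac{1}{(q;q)_\infty}\sum_{k\in\mathbb{Z}}\left(q^{15k^2+k}-q^{15k^2+11k+2}\right).$$
   Context: $(q;q)_n=\prod_{j=1}^{n}(1-q^j)$ and $(q;q)_\infty=\prod_{j\ge1}(1-q^j)$. -}

module Defs where

open import Data.Nat as ℕ using (ℕ; zero; suc)
open import Data.Integer using (ℤ; +_; -[1+_]; _+_; _*_; -_; _-_; _≤_; 0ℤ; 1ℤ; ∣_∣; +≤+)
open import Data.Integer.Properties
open import Data.Integer.Solver using (module +-*-Solver)
open import Data.Fin using (Fin; zero; suc; toℕ)
open import Data.Vec using (Vec; []; _∷_; head; lookup)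
open import Data.Product using (∃-syntax)
open import Relation.Nullary using (yes; no)
open import Relation.Binary.PropositionalEquality
open import Algebra.Properties.Semiring.Sum +-*-semiring using (sum-syntax; sum⁺-syntax; sum-cong-≗)

-- A series is its sequence of coefficients: f n is the coefficient of qⁿ.

ℤ⟦q⟧ : Set
ℤ⟦q⟧ = ℕ → ℤ

infix  4 _≋_ _⟶_
infixl 6 _⊖_
infixl 7 _⊛_
infix  8 _⁻¹
infix  9 q^_

_≋_ : ℤ⟦q⟧ → ℤ⟦q⟧ → Set
f ≋ g = ∀ n → f n ≡ g n

q^_ : ℕ → ℤ⟦q⟧
(q^ e) n with e ℕ.≟ n
... | yes _ = 1ℤ
... | no  _ = 0ℤ

𝟙 : ℤ⟦q⟧
𝟙 = q^ 0

_⊖_ : ℤ⟦q⟧ → ℤ⟦q⟧ → ℤ⟦q⟧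
(f ⊖ g) n = f n - g n

_⊛_ : ℤ⟦q⟧ → ℤ⟦q⟧ → ℤ⟦q⟧
(f ⊛ g) n = ∑[ i ≤ n ] (f (toℕ i) * g (n ℕ.∸ toℕ i))

-- For f with constant term 1, the coefficients gₙ ∷ … ∷ g₀ of 1/f, from
-- gₙ₊₁ = - (f₁ gₙ + f₂ gₙ₋₁ + … + fₙ₊₁ g₀).

inverseCoeffs : ℤ⟦q⟧ → (n : ℕ) → Vec ℤ (suc n)
inverseCoeffs f zero    = 1ℤ ∷ []
inverseCoeffs f (suc n) = - (∑[ i ≤ n ] (f (suc (toℕ i)) * lookup gs i)) ∷ gs
  where gs = inverseCoeffs f n

-- The multiplicative inverse of a series with constant term 1 (see
-- ⁻¹-inverseʳ); it has no meaning for other series.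

_⁻¹ : ℤ⟦q⟧ → ℤ⟦q⟧
(f ⁻¹) n = head (inverseCoeffs f n)

lookup-inverseCoeffs : ∀ f n (i : Fin (suc n)) →
                       lookup (inverseCoeffs f n) i ≡ (f ⁻¹) (n ℕ.∸ toℕ i)
lookup-inverseCoeffs f zero    zero    = refl
lookup-inverseCoeffs f (suc n) zero    = refl
lookup-inverseCoeffs f (suc n) (suc i) = lookup-inverseCoeffs f n i

⁻¹-inverseʳ : ∀ f → f 0 ≡ 1ℤ → f ⊛ f ⁻¹ ≋ 𝟙
⁻¹-inverseʳ f f₀≡1 zero    = cong (λ c → c * 1ℤ + 0ℤ) f₀≡1
⁻¹-inverseʳ f f₀≡1 (suc n) = begin
  f 0 * - s + t     ≡⟨ cong (λ c → c * - s + t) f₀≡1 ⟩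
  1ℤ * - s + t      ≡⟨ cong (_+ t) (*-identityˡ (- s)) ⟩
  - s + t           ≡⟨ cong (λ u → - s + u) (sym s≡t) ⟩
  - s + s           ≡⟨ +-inverseˡ s ⟩
  0ℤ                ∎
  where
  open ≡-Reasoning
  s = ∑[ i ≤ n ] (f (suc (toℕ i)) * lookup (inverseCoeffs f n) i)
  t = ∑[ i ≤ n ] (f (suc (toℕ i)) * (f ⁻¹) (n ℕ.∸ toℕ i))
  s≡t : s ≡ t
  s≡t = sum-cong-≗ {suc n} (λ i → cong (f (suc (toℕ i)) *_) (lookup-inverseCoeffs f n i))

-- (q;q)ₙ

qPoch : ℕ → ℤ⟦q⟧
qPoch zero    = 𝟙
qPoch (suc n) = qPoch n ⊛ (𝟙 ⊖ q^ suc n)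

qPoch-constantTerm : ∀ n → qPoch n 0 ≡ 1ℤ
qPoch-constantTerm zero    = refl
qPoch-constantTerm (suc n) = cong (λ c → c * 1ℤ + 0ℤ) (qPoch-constantTerm n)

-- Convergence in the q-adic topology: every coefficient is eventually constant.

_⟶_ : (ℕ → ℤ⟦q⟧) → ℤ⟦q⟧ → Set
s ⟶ f = ∀ n → ∃[ N ] ∀ m → N ℕ.≤ m → s m n ≡ f n

HasSum : (ℕ → ℤ⟦q⟧) → ℤ⟦q⟧ → Set
HasSum a f = (λ N n → ∑[ k < N ] a (toℕ k) n) ⟶ f

-- The partial sums run over -M ≤ k < N, with M and N growing independently.

HasSumℤ : (ℤ → ℤ⟦q⟧) → ℤ⟦q⟧ → Set
HasSumℤ a f = ∀ n → ∃[ K ] ∀ M N → K ℕ.≤ M → K ℕ.≤ N →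
  (∑[ k < M ] a -[1+ toℕ k ] n) + (∑[ k < N ] a (+ toℕ k) n) ≡ f n

-- A power of q whose exponent is an integer known to be nonnegative.

q^⟨_,_⟩ : (e : ℤ) → 0ℤ ≤ e → ℤ⟦q⟧
q^⟨ e , _ ⟩ = q^ ∣ e ∣

private
  quadratic≥0 : ∀ a b c n → 0ℤ ≤ + a * (+ n * + n) + + b * + n + + c
  quadratic≥0 a b c n = subst (0ℤ ≤_) eq (+≤+ ℕ.z≤n)
    where
    eq : + (a ℕ.* (n ℕ.* n) ℕ.+ b ℕ.* n ℕ.+ c) ≡ + a * (+ n * + n) + + b * + n + + c
    eq = cong (_+ + c) (cong₂ _+_
           (trans (pos-* a (n ℕ.* n)) (cong (+ a *_) (pos-* n n)))
           (pos-* b n))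

  open +-*-Solver

15k²+k≥0 : ∀ k → 0ℤ ≤ + 15 * (k * k) + k
15k²+k≥0 (+ n) = subst (0ℤ ≤_)
  (solve 1 (λ x → con (+ 15) :* (x :* x) :+ con (+ 1) :* x :+ con (+ 0)
                  := con (+ 15) :* (x :* x) :+ x) refl (+ n))
  (quadratic≥0 15 1 0 n)
15k²+k≥0 -[1+ n ] = subst (0ℤ ≤_)
  (solve 1 (λ x → let k = :- (con (+ 1) :+ x) in
                  con (+ 15) :* (x :* x) :+ con (+ 29) :* x :+ con (+ 14)
                  := con (+ 15) :* (k :* k) :+ k) refl (+ n))
  (quadratic≥0 15 29 14 n)

15k²+11k+2≥0 : ∀ k → 0ℤ ≤ + 15 * (k * k) + + 11 * k + + 2
15k²+11k+2≥0 (+ n)    = quadratic≥0 15 11 2 n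
15k²+11k+2≥0 -[1+ n ] = subst (0ℤ ≤_)
  (solve 1 (λ x → let k = :- (con (+ 1) :+ x) in
                  con (+ 15) :* (x :* x) :+ con (+ 19) :* x :+ con (+ 6)
                  := con (+ 15) :* (k :* k) :+ con (+ 11) :* k :+ con (+ 2)) refl (+ n))
  (quadratic≥0 15 19 6 n)

{-# OPTIONS --safe #-}

-- With eₙ = 1/(q;q)ₙ, Schur's identity
-- ∑ⱼ (-1)ʲ q^(j(3j+1)/2) [2n; ⌊(2n-3j)/2⌋] = 1 says that e₂ₙ = ∑ᵣ αᵣ eₙ₋ᵣ eₙ₊ᵣ,
-- a Bailey pair: αᵣ = q^(6k²+k) for r = 3k, -q^(6k²+5k+1) for r = 3k+1, and 0
-- otherwise. It follows from Pascal's rules by passing from n - 1/2 to n and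
-- from n to n + 1/2, the remaining terms cancelling in pairs or telescoping.
-- Bailey's lemma ∑ₙ q^(n²) e_(L-n) eₙ₋ᵣ eₙ₊ᵣ = q^(r²) e_(L-r) e_(L+r) turns it into
--   ∑ₙ q^(n²) e_(L-n) e₂ₙ = ∑ᵣ αᵣ q^(r²) e_(L-r) e_(L+r).
-- After multiplication by (q;q)_L, both sides agree modulo q^(L+1) with those of
-- the theorem.

module Submission where

open import Defs
open import Algebra.Bundles using (AbelianGroup; CommutativeRing; Semiring)
open import Algebra.Construct.Pointwise using (abelianGroup)
open import Data.Fin using (toℕ)
open import Data.Fin.Properties using (toℕ<n)
open import Data.Integer.Solver using (module +-*-Solver)
import Data.Integer.Properties as ℤ
open import Data.Nat as ℕ using (ℕ; zero; suc; z≤n; s≤s; _∸_) renaming (_*_ to _*ℕ_; _^_ to _^ℕ_)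
import Data.Nat.Properties as ℕ
open import Data.Nat.Tactic.RingSolver using (solve-∀)
open import Data.Product using (∃-syntax; _×_; _,_; proj₂)
open import Data.Sum using (inj₁; inj₂)
open import Function using (_∘_)
open import Level using (0ℓ; _⊔_)
open import Relation.Binary.Bundles using (Setoid)
open import Relation.Binary.PropositionalEquality as ≡ using (_≡_)
import Relation.Binary.Reasoning.Setoid as SetoidReasoning
open import Relation.Nullary using (yes; no; contradiction)

-- Dividing Schur's identity by (q;q)₂ₙ turns every Gaussian binomial into a product of two of the
-- eₙ. Only qⁿ, (q;q)ₙ and its inverse then matter, and the finite part runs over any commutative
-- ring that has them. The nuisance is n - r: it occurs as an index and as an exponent, and r may
-- exceed n. Setting 1/(q;q)ₙ₋ᵣ to 0 for r > n removes the side conditions, and exponents are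
-- arranged so that each qⁿ⁻ʳ is absorbed by a factor qʳ.
--
-- The sum over r is two-sided; replacing negative r by -r gives groups of four, at 3k, 3k+1, 3k+2,
-- 3k+3 with k ≥ 0. Adding r² to the exponents of αᵣ yields those of the theorem: 6k²+k + (3k)² =
-- 15k²+k and 6k²+5k+1 + (3k+1)² = 15k²+11k+2.
--
-- As L grows, e_(L-n) tends to 1/(q;q)_∞ and e_(L-r) e_(L+r) to its square, so the factor (q;q)_L
-- leaves exactly one 1/(q;q)_∞, on the right. A single L settles each coefficient, so congruences
-- replace limits.

-- Finite sums over initial segments

module SequenceSums {c ℓ} (R : Semiring c ℓ) where

  open Semiring R
  open import Algebra.Properties.Semiring.Sum R
    using (sum; sum-cong-≋; sum-replicate-zero; ∑-distrib-+; *-distribˡ-sum)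
    renaming (∑-comm to sum-comm)

  -- Summands live on ℕ rather than `Fin n`, so that they survive a change of bound; the sum still
  -- unfolds to the form used in `HasSum`.
  ∑ : ℕ → (ℕ → Carrier) → Carrier
  ∑ n f = sum {n} (f ∘ toℕ)

  infixl 10 ∑
  syntax ∑ n (λ i → x) = ∑[ i < n ] x

  ∑-cong : ∀ n {f g} → (∀ i → i ℕ.< n → f i ≈ g i) → ∑ n f ≈ ∑ n g
  ∑-cong n f≈g = sum-cong-≋ {n} (λ i → f≈g (toℕ i) (toℕ<n i))

  ∑-zero : ∀ n {f} → (∀ i → i ℕ.< n → f i ≈ 0#) → ∑ n f ≈ 0#
  ∑-zero n {f} f≈0 = trans (∑-cong n {f} {λ _ → 0#} f≈0) (sum-replicate-zero n)

  ∑-+ : ∀ n (f g : ℕ → Carrier) → ∑[ i < n ] (f i + g i) ≈ ∑ n f + ∑ n g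
  ∑-+ n f g = ∑-distrib-+ {n} (f ∘ toℕ) (g ∘ toℕ)

  *-distribˡ-∑ : ∀ n x f → x * ∑ n f ≈ ∑[ i < n ] (x * f i)
  *-distribˡ-∑ n x f = *-distribˡ-sum {n} x (f ∘ toℕ)

  ∑-comm : ∀ m n (f : ℕ → ℕ → Carrier) → ∑[ i < m ] ∑[ j < n ] f i j ≈ ∑[ j < n ] ∑[ i < m ] f i j
  ∑-comm m n f = sum-comm {m} {n} (λ i j → f (toℕ i) (toℕ j))

  ∑-split : ∀ m n (f : ℕ → Carrier) →
            ∑[ i < m ℕ.+ n ] f i ≈ ∑[ i < m ] f i + ∑[ i < n ] f (m ℕ.+ i)
  ∑-split zero    n f = sym (+-identityˡ _)
  ∑-split (suc m) n f = trans (+-congˡ (∑-split m n (f ∘ suc))) (sym (+-assoc _ _ _))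

  ∑-truncate : ∀ {m n} (f : ℕ → Carrier) → m ℕ.≤ n → (∀ i → m ℕ.≤ i → f i ≈ 0#) → ∑ n f ≈ ∑ m f
  ∑-truncate {m} f m≤n f≈0 with ℕ.m≤n⇒∃[o]m+o≡n m≤n
  ... | o , ≡.refl = trans (∑-split m o f)
    (trans (+-congˡ (∑-zero o (λ i _ → f≈0 (m ℕ.+ i) (ℕ.m≤m+n m i)))) (+-identityʳ _))

-- q-factorials and their inverses in a commutative ring

-- Q n, p n and e n stand for qⁿ, (q;q)ₙ and 1/(q;q)ₙ.
record QFactorial {c ℓ} (R : CommutativeRing c ℓ) : Set (c ⊔ ℓ) where
  open CommutativeRing R
  field
    Q p e : ℕ → Carrier
    Q-0   : Q 0 ≈ 1#
    Q-+   : ∀ m n → Q (m ℕ.+ n) ≈ Q m * Q n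
    p-0   : p 0 ≈ 1#
    p-suc : ∀ n → p (suc n) ≈ p n * (1# - Q (suc n))
    p*e≈1 : ∀ n → p n * e n ≈ 1#

module BaileyPair {c ℓ} (R : CommutativeRing c ℓ) (𝒬 : QFactorial R) where

  open CommutativeRing R
  open QFactorial 𝒬
  open import Algebra.Properties.Ring ring
  open SequenceSums semiring
  open import Algebra.Solver.Ring.NaturalCoefficients.Default commutativeSemiring
  open import Relation.Binary.Reasoning.Setoid setoid

  -‿telescope : ∀ x y z → (x - y) + (y - z) ≈ x - z
  -‿telescope x y z = begin
    (x - y) + (y - z)      ≈⟨ solve 4 (λ x y y′ z′ → (x :+ y′) :+ (y :+ z′) := (x :+ z′) :+ (y′ :+ y)) refl x y (- y) (- z) ⟩
    (x - z) + (- y + y)    ≈⟨ +-congˡ (-‿inverseˡ y) ⟩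
    (x - z) + 0#           ≈⟨ +-identityʳ _ ⟩
    x - z                  ∎

  ∑-telescope : ∀ n (f : ℕ → Carrier) →
                ∑[ i < n ] (f i - f (suc i)) ≈ f 0 - f n
  ∑-telescope zero    f = sym (-‿inverseʳ _)
  ∑-telescope (suc n) f = trans (+-congˡ (∑-telescope n (f ∘ suc))) (-‿telescope _ _ _)

  u : ℕ → Carrier
  u n = 1# - Q n

  -- The source of both Pascal rules, which differ only in the order of the two summands of the
  -- index.
  u-+ : ∀ m n → u (m ℕ.+ n) ≈ u m + Q m * u n
  u-+ m n = begin
    1# - Q (m ℕ.+ n)              ≈⟨ +-congˡ (-‿cong (Q-+ m n)) ⟩
    1# - Q m * Q n                ≈⟨ -‿telescope _ _ _ ⟨
    u m + (Q m - Q m * Q n)       ≈⟨ +-congˡ (+-cong (sym (*-identityʳ _)) (-‿distribʳ-* _ _)) ⟩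
    u m + (Q m * 1# + Q m * - Q n) ≈⟨ +-congˡ (distribˡ _ _ _) ⟨
    u m + Q m * u n               ∎

  u-0 : u 0 ≈ 0#
  u-0 = trans (+-congˡ (-‿cong Q-0)) (-‿inverseʳ _)

  e-0 : e 0 ≈ 1#
  e-0 = begin
    e 0       ≈⟨ *-identityˡ _ ⟨
    1# * e 0  ≈⟨ *-congʳ p-0 ⟨
    p 0 * e 0 ≈⟨ p*e≈1 0 ⟩
    1#        ∎

  e-suc : ∀ n → u (suc n) * e (suc n) ≈ e n
  e-suc n = begin
    u (suc n) * e (suc n)                       ≈⟨ *-identityˡ _ ⟨
    1# * (u (suc n) * e (suc n))                ≈⟨ *-congʳ (p*e≈1 n) ⟨
    p n * e n * (u (suc n) * e (suc n))         ≈⟨ solve 4 (λ a b c d → a :* b :* (c :* d) := b :* (a :* c :* d)) refl _ _ _ _ ⟩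
    e n * (p n * u (suc n) * e (suc n))         ≈⟨ *-congˡ (*-congʳ (p-suc n)) ⟨
    e n * (p (suc n) * e (suc n))               ≈⟨ *-congˡ (p*e≈1 (suc n)) ⟩
    e n * 1#                                    ≈⟨ *-identityʳ _ ⟩
    e n                                         ∎

  -- 1 - qⁿ⁺¹ is a unit: its inverse is (q;q)ₙ/(q;q)ₙ₊₁.
  u-cancel : ∀ n {x y} → u (suc n) * x ≈ u (suc n) * y → x ≈ y
  u-cancel n {x} {y} eq = begin
    x                                  ≈⟨ expand x ⟩
    e (suc n) * p n * (u (suc n) * x)  ≈⟨ *-congˡ eq ⟩
    e (suc n) * p n * (u (suc n) * y)  ≈⟨ expand y ⟨
    y                                  ∎
    where
    expand : ∀ z → z ≈ e (suc n) * p n * (u (suc n) * z)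
    expand z = begin
      z                                  ≈⟨ *-identityˡ _ ⟨
      1# * z                             ≈⟨ *-congʳ (p*e≈1 (suc n)) ⟨
      p (suc n) * e (suc n) * z          ≈⟨ *-congʳ (*-congʳ (p-suc n)) ⟩
      p n * u (suc n) * e (suc n) * z    ≈⟨ solve 4 (λ a b c d → a :* b :* c :* d := c :* a :* (b :* d)) refl _ _ _ _ ⟩
      e (suc n) * p n * (u (suc n) * z)  ∎

  -- 1/(q;q)ₙ₋ᵣ, which vanishes for r > n.
  d : ℕ → ℕ → Carrier
  d n       zero    = e n
  d zero    (suc r) = 0#
  d (suc n) (suc r) = d n r

  d-vanish : ∀ {n r} → n ℕ.< r → d n r ≈ 0#
  d-vanish {zero}  {suc r} _         = refl
  d-vanish {suc n} {suc r} (s≤s n<r) = d-vanish n<r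

  d-shift : ∀ r m n → d (r ℕ.+ m) (r ℕ.+ n) ≡ d m n
  d-shift zero    m n = ≡.refl
  d-shift (suc r) m n = d-shift r m n

  d-diagonal : ∀ r m → d (r ℕ.+ m) r ≡ e m
  d-diagonal r m = ≡.trans (≡.cong (d (r ℕ.+ m)) (≡.sym (ℕ.+-identityʳ r))) (d-shift r m 0)

  -- `e-suc` extended past the boundary: at r = n the factor `u 0` is 0, in agreement with the value
  -- of `d n (suc n)`, and beyond it `d` is already 0.
  d-sucʳ : ∀ n r → u (n ∸ r) * d n r ≈ d n (suc r)
  d-sucʳ zero    zero    = trans (*-congʳ u-0) (zeroˡ _)
  d-sucʳ (suc n) zero    = e-suc n
  d-sucʳ zero    (suc r) = zeroʳ _
  d-sucʳ (suc n) (suc r) = d-sucʳ n r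

  -- Truncated subtraction is harmless next to `d n r`, which vanishes exactly where n ∸ r is
  -- truncated to a wrong value.
  Q-∸ : ∀ a n r → Q (a ℕ.+ r) * (Q (n ∸ r) * d n r) ≈ Q (a ℕ.+ n) * d n r
  Q-∸ a n r with ℕ.≤-<-connex r n
  ... | inj₁ r≤n = begin
    Q (a ℕ.+ r) * (Q (n ∸ r) * d n r)   ≈⟨ *-assoc _ _ _ ⟨
    Q (a ℕ.+ r) * Q (n ∸ r) * d n r     ≈⟨ *-congʳ (Q-+ _ _) ⟨
    Q (a ℕ.+ r ℕ.+ (n ∸ r)) * d n r     ≡⟨ ≡.cong (λ k → Q k * d n r) (≡.trans (ℕ.+-assoc a r (n ∸ r)) (≡.cong (a ℕ.+_) (ℕ.m+[n∸m]≡n r≤n))) ⟩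
    Q (a ℕ.+ n) * d n r                 ∎
  ... | inj₂ n<r = begin
    Q (a ℕ.+ r) * (Q (n ∸ r) * d n r)   ≈⟨ *-congˡ (trans (*-congˡ (d-vanish n<r)) (zeroʳ _)) ⟩
    Q (a ℕ.+ r) * 0#                    ≈⟨ zeroʳ _ ⟩
    0#                                  ≈⟨ zeroʳ _ ⟨
    Q (a ℕ.+ n) * 0#                    ≈⟨ *-congˡ (d-vanish n<r) ⟨
    Q (a ℕ.+ n) * d n r                 ∎

  -- Pascal's rules for divided Gaussian binomials

  -- For r ≤ n this is [n-r+m; m]/(q;q)ₙ₋ᵣ₊ₘ. The index m stays free because both m = n+r and m =
  -- n+r+1 occur.
  W : ℕ → ℕ → ℕ → Carrier
  W n r m = d n r * e m

  W-vanish : ∀ {n r} → n ℕ.< r → ∀ m → W n r m ≈ 0#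
  W-vanish n<r m = trans (*-congʳ (d-vanish n<r)) (zeroˡ _)

  -- For r > n the two indices of `u` may differ, but `W` is 0. Pascal's rules therefore hold for
  -- all r, with s independent of r in the applications to Schur's identity.
  u-W : ∀ {s n r m} → s ℕ.+ r ≡ n ℕ.+ m → u s * W n r m ≈ u (n ∸ r ℕ.+ m) * W n r m
  u-W {s} {n} {r} {m} s+r≡n+m with ℕ.≤-<-connex r n
  ... | inj₁ r≤n = reflexive (≡.cong (λ k → u k * W n r m) (ℕ.+-cancelʳ-≡ r s _ (≡.trans s+r≡n+m
    (≡.trans (≡.cong (ℕ._+ m) (≡.sym (ℕ.m∸n+n≡m r≤n))) (swap (n ∸ r) r m)))))
    where
    swap : ∀ a b c → a ℕ.+ b ℕ.+ c ≡ a ℕ.+ c ℕ.+ b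
    swap = solve-∀
  ... | inj₂ n<r = trans (vanish s) (sym (vanish (n ∸ r ℕ.+ m)))
    where
    vanish : ∀ k → u k * W n r m ≈ 0#
    vanish k = trans (*-congˡ (W-vanish n<r m)) (zeroʳ _)

  -- The two Pascal rules for the Gaussian binomial [s; n-r], s = (n-r) + (m+1),
  -- divided by (q;q)ₛ₋₁.
  pascal⁻ : ∀ {s n r m} → s ℕ.+ r ≡ n ℕ.+ suc m →
            u s * W n r (suc m) ≈ W n (suc r) (suc m) + Q (n ∸ r) * W n r m
  pascal⁻ {s} {n} {r} {m} eq = begin
    u s * W n r (suc m)                       ≈⟨ u-W eq ⟩
    u (n ∸ r ℕ.+ suc m) * W n r (suc m)       ≈⟨ *-congʳ (u-+ _ _) ⟩
    (u (n ∸ r) + Q (n ∸ r) * u (suc m)) * W n r (suc m)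
      ≈⟨ solve 5 (λ a b c d e → (a :+ b :* c) :* (d :* e) := a :* d :* e :+ b :* (d :* (c :* e))) refl _ _ _ _ _ ⟩
    u (n ∸ r) * d n r * e (suc m) + Q (n ∸ r) * (d n r * (u (suc m) * e (suc m)))
      ≈⟨ +-cong (*-congʳ (d-sucʳ n r)) (*-congˡ (*-congˡ (e-suc m))) ⟩
    W n (suc r) (suc m) + Q (n ∸ r) * W n r m ∎

  pascal⁺ : ∀ {s n r m} → s ℕ.+ r ≡ n ℕ.+ suc m →
            u s * W n r (suc m) ≈ W n r m + Q (suc m) * W n (suc r) (suc m)
  pascal⁺ {s} {n} {r} {m} eq = begin
    u s * W n r (suc m)                       ≈⟨ u-W eq ⟩
    u (n ∸ r ℕ.+ suc m) * W n r (suc m)       ≡⟨ ≡.cong (λ k → u k * W n r (suc m)) (ℕ.+-comm (n ∸ r) (suc m)) ⟩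
    u (suc m ℕ.+ (n ∸ r)) * W n r (suc m)     ≈⟨ *-congʳ (u-+ _ _) ⟩
    (u (suc m) + Q (suc m) * u (n ∸ r)) * W n r (suc m)
      ≈⟨ solve 5 (λ a b c d e → (a :+ b :* c) :* (d :* e) := d :* (a :* e) :+ b :* (c :* d :* e)) refl _ _ _ _ _ ⟩
    d n r * (u (suc m) * e (suc m)) + Q (suc m) * (u (n ∸ r) * d n r * e (suc m))
      ≈⟨ +-cong (*-congˡ (e-suc m)) (*-congˡ (*-congʳ (d-sucʳ n r))) ⟩
    W n r m + Q (suc m) * W n (suc r) (suc m) ∎

  -- With the exponent written as a + r, the factor qⁿ⁻ʳ of `pascal⁻` leaves qᵃ⁺ⁿ. This form can be
  -- matched against the second term of `step⁺`.
  step⁻ : ∀ a {s n r m} → s ℕ.+ r ≡ n ℕ.+ suc m →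
          Q (a ℕ.+ r) * (u s * W n r (suc m))
            ≈ Q (a ℕ.+ r) * W n (suc r) (suc m) + Q (a ℕ.+ n) * W n r m
  step⁻ a {s} {n} {r} {m} eq = begin
    Q (a ℕ.+ r) * (u s * W n r (suc m))
      ≈⟨ *-congˡ (pascal⁻ eq) ⟩
    Q (a ℕ.+ r) * (W n (suc r) (suc m) + Q (n ∸ r) * (d n r * e m))
      ≈⟨ solve 5 (λ a b c d e → a :* (b :+ c :* (d :* e)) := a :* b :+ a :* (c :* d) :* e) refl _ _ _ _ _ ⟩
    Q (a ℕ.+ r) * W n (suc r) (suc m) + Q (a ℕ.+ r) * (Q (n ∸ r) * d n r) * e m
      ≈⟨ +-congˡ (*-congʳ (Q-∸ a n r)) ⟩
    Q (a ℕ.+ r) * W n (suc r) (suc m) + Q (a ℕ.+ n) * d n r * e m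
      ≈⟨ +-congˡ (*-assoc _ _ _) ⟩
    Q (a ℕ.+ r) * W n (suc r) (suc m) + Q (a ℕ.+ n) * W n r m ∎

  step⁺ : ∀ a {s n r m} → s ℕ.+ r ≡ n ℕ.+ suc m →
          Q a * (u s * W n r (suc m))
            ≈ Q a * W n r m + Q (a ℕ.+ suc m) * W n (suc r) (suc m)
  step⁺ a {s} {n} {r} {m} eq = begin
    Q a * (u s * W n r (suc m))
      ≈⟨ *-congˡ (pascal⁺ eq) ⟩
    Q a * (W n r m + Q (suc m) * W n (suc r) (suc m))
      ≈⟨ solve 4 (λ a b c d → a :* (b :+ c :* d) := a :* b :+ (a :* c) :* d) refl _ _ _ _ ⟩
    Q a * W n r m + Q a * Q (suc m) * W n (suc r) (suc m)
      ≈⟨ +-congˡ (*-congʳ (Q-+ _ _)) ⟨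
    Q a * W n r m + Q (a ℕ.+ suc m) * W n (suc r) (suc m) ∎

  -- Durfee rectangles and Bailey's lemma

  -- A case of q-Vandermonde. Multiplied by (q;q)_M, it sorts partitions with parts at most M+s by
  -- their largest m × (m+s) rectangle. In the induction on M, Pascal's rule produces a second sum
  -- with m lowered and s raised by 1; hence s is general, and so is the bound K, which differs
  -- between the two sums.
  ∑-Durfee : ∀ {K M} → M ℕ.< K → ∀ s →
             ∑[ m < K ] (Q (m ℕ.* (m ℕ.+ s)) * W M m m * e (m ℕ.+ s))
               ≈ e M * e (M ℕ.+ s)
  ∑-Durfee {suc K} {zero} (s≤s z≤n) s = begin
    Q 0 * (e 0 * e 0) * e s + ∑[ m < K ] (T (suc m))
      ≈⟨ +-cong (*-congʳ (trans (*-cong Q-0 (*-congʳ e-0)) (trans (*-identityˡ _) (*-identityˡ _))))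
                (∑-zero K {T ∘ suc} λ m _ → trans (*-congʳ (trans (*-congˡ (zeroˡ _)) (zeroʳ _))) (zeroˡ _)) ⟩
    e 0 * e s + 0#     ≈⟨ +-identityʳ _ ⟩
    e 0 * e s ∎
    where
    T : ℕ → Carrier
    T m = Q (m ℕ.* (m ℕ.+ s)) * W 0 m m * e (m ℕ.+ s)
  ∑-Durfee {suc K} {suc M} (s≤s M<K) s = u-cancel M (begin
    u (suc M) * ∑[ m < suc K ] T (suc M) s m
      ≈⟨ distribˡ _ _ _ ⟩
    u (suc M) * T (suc M) s 0 + u (suc M) * ∑[ m < K ] T (suc M) s (suc m)
      ≈⟨ +-cong first (trans (*-distribˡ-∑ K _ (T (suc M) s ∘ suc)) (∑-cong K (λ m _ → rest m))) ⟩
    T M s 0 + ∑[ m < K ] (T M s (suc m) + Q (suc M ℕ.+ s) * T M (suc s) m)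
      ≈⟨ +-congˡ (∑-+ K (T M s ∘ suc) (λ m → Q (suc M ℕ.+ s) * T M (suc s) m)) ⟩
    T M s 0 + (∑[ m < K ] T M s (suc m) + ∑[ m < K ] (Q (suc M ℕ.+ s) * T M (suc s) m))
      ≈⟨ +-assoc _ _ _ ⟨
    ∑[ m < suc K ] T M s m + ∑[ m < K ] (Q (suc M ℕ.+ s) * T M (suc s) m)
      ≈⟨ +-cong (∑-Durfee (ℕ.m<n⇒m<1+n M<K) s) (sym (*-distribˡ-∑ K _ (T M (suc s)))) ⟩
    e M * e (M ℕ.+ s) + Q (suc M ℕ.+ s) * ∑[ m < K ] T M (suc s) m
      ≈⟨ +-congˡ (*-congˡ (∑-Durfee M<K (suc s))) ⟩
    e M * e (M ℕ.+ s) + Q (suc M ℕ.+ s) * (e M * e (M ℕ.+ suc s))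
      ≡⟨ ≡.cong (λ k → e M * e (M ℕ.+ s) + Q (suc M ℕ.+ s) * (e M * e k)) (ℕ.+-suc M s) ⟩
    -- Over the common denominator (q;q)_(M+s+1) the two terms have coefficients `u` and `Q` at the
    -- same index, which add up to 1.
    e M * e (M ℕ.+ s) + Q (suc M ℕ.+ s) * (e M * e (suc M ℕ.+ s))
      ≈⟨ +-congʳ (*-congˡ (e-suc (M ℕ.+ s))) ⟨
    e M * (u (suc M ℕ.+ s) * e (suc M ℕ.+ s)) + Q (suc M ℕ.+ s) * (e M * e (suc M ℕ.+ s))
      ≈⟨ solve 4 (λ a b c d → a :* (b :* c) :+ d :* (a :* c) := a :* ((b :+ d) :* c)) refl _ _ _ _ ⟩
    e M * ((u (suc M ℕ.+ s) + Q (suc M ℕ.+ s)) * e (suc M ℕ.+ s))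
      ≈⟨ *-cong (sym (e-suc M)) (trans (*-congʳ (trans (+-assoc _ _ _) (trans (+-congˡ (-‿inverseˡ _)) (+-identityʳ _)))) (*-identityˡ _)) ⟩
    u (suc M) * e (suc M) * e (suc M ℕ.+ s)
      ≈⟨ *-assoc _ _ _ ⟩
    u (suc M) * (e (suc M) * e (suc M ℕ.+ s)) ∎)
    where
    T : ℕ → ℕ → ℕ → Carrier
    T M s m = Q (m ℕ.* (m ℕ.+ s)) * W M m m * e (m ℕ.+ s)

    first : u (suc M) * T (suc M) s 0 ≈ T M s 0
    first = trans
      (solve 5 (λ a b c d e → a :* (b :* (c :* d) :* e) := b :* (a :* c :* d) :* e) refl _ _ _ _ _)
      (*-congʳ (*-congˡ (*-congʳ (e-suc M))))

    exponent₁ : ∀ m s → suc m ℕ.* (suc m ℕ.+ s) ≡ suc m ℕ.* (m ℕ.+ s) ℕ.+ suc m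
    exponent₁ = solve-∀

    exponent₂ : ∀ M m s → suc m ℕ.* (m ℕ.+ s) ℕ.+ suc M ≡ suc M ℕ.+ s ℕ.+ m ℕ.* (m ℕ.+ suc s)
    exponent₂ = solve-∀

    rest : ∀ m → u (suc M) * T (suc M) s (suc m) ≈ T M s (suc m) + Q (suc M ℕ.+ s) * T M (suc s) m
    rest m = begin
      u (suc M) * T (suc M) s (suc m)
        ≈⟨ solve 4 (λ a b c d → a :* (b :* c :* d) := b :* (a :* c) :* d) refl _ _ _ _ ⟩
      Q (suc m ℕ.* (suc m ℕ.+ s)) * (u (suc M) * W (suc M) (suc m) (suc m)) * e (suc m ℕ.+ s)
        ≡⟨ ≡.cong (λ k → Q k * (u (suc M) * W (suc M) (suc m) (suc m)) * e (suc m ℕ.+ s)) (exponent₁ m s) ⟩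
      Q (a ℕ.+ suc m) * (u (suc M) * W (suc M) (suc m) (suc m)) * e (suc m ℕ.+ s)
        ≈⟨ *-congʳ (step⁻ a ≡.refl) ⟩
      (Q (a ℕ.+ suc m) * W M (suc m) (suc m) + Q (a ℕ.+ suc M) * W M m m) * e (suc m ℕ.+ s)
        ≈⟨ distribʳ _ _ _ ⟩
      Q (a ℕ.+ suc m) * W M (suc m) (suc m) * e (suc m ℕ.+ s) + Q (a ℕ.+ suc M) * W M m m * e (suc m ℕ.+ s)
        ≡⟨ ≡.cong₂ (λ k l → Q k * W M (suc m) (suc m) * e (suc m ℕ.+ s) + Q (a ℕ.+ suc M) * W M m m * e l)
             (≡.sym (exponent₁ m s)) (≡.sym (ℕ.+-suc m s)) ⟩
      T M s (suc m) + Q (a ℕ.+ suc M) * W M m m * e (m ℕ.+ suc s)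
        ≈⟨ +-congˡ (*-congʳ (*-congʳ (trans (reflexive (≡.cong Q (exponent₂ M m s))) (Q-+ _ _)))) ⟩
      T M s (suc m) + Q (suc M ℕ.+ s) * Q (m ℕ.* (m ℕ.+ suc s)) * W M m m * e (m ℕ.+ suc s)
        ≈⟨ +-congˡ (solve 4 (λ a b c d → a :* b :* c :* d := a :* (b :* c :* d)) refl _ _ _ _) ⟩
      T M s (suc m) + Q (suc M ℕ.+ s) * T M (suc s) m ∎
      where
      a = suc m ℕ.* (m ℕ.+ s)

  -- The terms with n < r vanish. For n = r+m, n² = r² + m(m+2r), which leaves `∑-Durfee` with M =
  -- L-r and s = 2r.
  baileyLemma : ∀ L r → ∑[ n < suc L ] (Q (n ℕ.* n) * d L n * W n r (r ℕ.+ n))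
                          ≈ Q (r ℕ.* r) * W L r (r ℕ.+ L)
  baileyLemma L r with ℕ.≤-<-connex r L
  ... | inj₂ L<r = trans
    (∑-zero (suc L) {λ n → Q (n ℕ.* n) * d L n * W n r (r ℕ.+ n)} λ { n (s≤s n≤L) → trans (*-congˡ (W-vanish (ℕ.≤-<-trans n≤L L<r) _)) (zeroʳ _) })
    (sym (trans (*-congˡ (W-vanish L<r _)) (zeroʳ _)))
  ... | inj₁ r≤L with ℕ.m≤n⇒∃[o]m+o≡n r≤L
  ...   | M , ≡.refl = begin
    ∑[ n < suc (r ℕ.+ M) ] t n                              ≡⟨ ≡.cong (λ k → ∑[ n < k ] t n) (ℕ.+-suc r M) ⟨
    ∑[ n < r ℕ.+ suc M ] t n                                ≈⟨ ∑-split r (suc M) t ⟩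
    ∑[ n < r ] t n + ∑[ m < suc M ] t (r ℕ.+ m)         ≈⟨ +-cong (∑-zero r {t} λ n n<r → trans (*-congˡ (W-vanish n<r _)) (zeroʳ _))
                                                                       (∑-cong (suc M) {t ∘ (r ℕ.+_)} λ m _ → shift m) ⟩
    0# + ∑[ m < suc M ] (Q (r ℕ.* r) * t′ m)                ≈⟨ +-identityˡ _ ⟩
    ∑[ m < suc M ] (Q (r ℕ.* r) * t′ m)                     ≈⟨ *-distribˡ-∑ (suc M) _ t′ ⟨
    Q (r ℕ.* r) * ∑[ m < suc M ] t′ m                       ≈⟨ *-congˡ (∑-Durfee (ℕ.n<1+n M) (r ℕ.+ r)) ⟩
    Q (r ℕ.* r) * (e M * e (M ℕ.+ (r ℕ.+ r)))                     ≡⟨ ≡.cong₂ (λ x k → Q (r ℕ.* r) * (x * e k)) (≡.sym (d-diagonal r M)) (index r M) ⟩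
    Q (r ℕ.* r) * W (r ℕ.+ M) r (r ℕ.+ (r ℕ.+ M))                 ∎
    where
    t t′ : ℕ → Carrier
    t n = Q (n ℕ.* n) * d (r ℕ.+ M) n * W n r (r ℕ.+ n)
    t′ m = Q (m ℕ.* (m ℕ.+ (r ℕ.+ r))) * W M m m * e (m ℕ.+ (r ℕ.+ r))

    index : ∀ r m → m ℕ.+ (r ℕ.+ r) ≡ r ℕ.+ (r ℕ.+ m)
    index = solve-∀

    square : ∀ r m → (r ℕ.+ m) ℕ.* (r ℕ.+ m) ≡ r ℕ.* r ℕ.+ m ℕ.* (m ℕ.+ (r ℕ.+ r))
    square = solve-∀

    shift : ∀ m → t (r ℕ.+ m) ≈ Q (r ℕ.* r) * t′ m
    shift m = begin
      Q ((r ℕ.+ m) ℕ.* (r ℕ.+ m)) * d (r ℕ.+ M) (r ℕ.+ m) * (d (r ℕ.+ m) r * e (r ℕ.+ (r ℕ.+ m)))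
        ≈⟨ *-cong (*-cong (trans (reflexive (≡.cong Q (square r m))) (Q-+ _ _)) (reflexive (d-shift r M m)))
                  (*-cong (reflexive (d-diagonal r m)) (reflexive (≡.cong e (≡.sym (index r m))))) ⟩
      Q (r ℕ.* r) * Q (m ℕ.* (m ℕ.+ (r ℕ.+ r))) * d M m * (e m * e (m ℕ.+ (r ℕ.+ r)))
        ≈⟨ solve 5 (λ a b c d e → a :* b :* c :* (d :* e) := a :* (b :* (c :* d) :* e)) refl _ _ _ _ _ ⟩
      Q (r ℕ.* r) * t′ m ∎

  -- Schur's identity

  -- The exponents of Schur's identity ∑ⱼ (-1)ʲ q^(j(3j+1)/2) [n; ⌊(n-3j)/2⌋] = 1
  -- at j = 2k, -2k-1, 2k+1, -2k-2.
  ε₀ ε₁ ε₂ ε₃ : ℕ → ℕ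
  ε₀ k = 6 ℕ.* (k ℕ.* k) ℕ.+ k
  ε₁ k = 6 ℕ.* (k ℕ.* k) ℕ.+ 5 ℕ.* k ℕ.+ 1
  ε₂ k = 6 ℕ.* (k ℕ.* k) ℕ.+ 7 ℕ.* k ℕ.+ 2
  ε₃ k = 6 ℕ.* (k ℕ.* k) ℕ.+ 11 ℕ.* k ℕ.+ 5

  signed : ℕ → Carrier → Carrier → Carrier → Carrier → Carrier
  signed k x₀ x₁ x₂ x₃ = Q (ε₀ k) * x₀ - Q (ε₁ k) * x₁ - Q (ε₂ k) * x₂ + Q (ε₃ k) * x₃

  alternating-cong : ∀ {a b c d a′ b′ c′ d′} → a ≈ a′ → b ≈ b′ → c ≈ c′ → d ≈ d′ →
                     a - b - c + d ≈ a′ - b′ - c′ + d′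
  alternating-cong a≈ b≈ c≈ d≈ = +-cong (+-cong (+-cong a≈ (-‿cong b≈)) (-‿cong c≈)) d≈

  -- a, b, c, d are the terms wanted and v, w, v′, w′ the by-products of Pascal's rules, paired so
  -- that `odd→even` sees x - x and `even→odd` sees consecutive remainders.
  alternating-+ : ∀ a b c d v w v′ w′ →
                  (a + v) - (b + w) - (c + v′) + (d + w′) ≈ (a - b - c + d) + ((v - w) - (v′ - w′))
  alternating-+ a b c d v w v′ w′ = begin
    (a + v) - (b + w) - (c + v′) + (d + w′)
      ≈⟨ +-congʳ (+-cong (+-congˡ (-‿+-comm b w)) (-‿+-comm c v′)) ⟨
    (a + v) + (- b + - w) + (- c + - v′) + (d + w′)
      ≈⟨ solve 8 (λ a b c d v w v′ w′ → (a :+ v) :+ (b :+ w) :+ (c :+ v′) :+ (d :+ w′)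
           := (a :+ b :+ c :+ d) :+ ((v :+ w) :+ (w′ :+ v′))) refl a (- b) (- c) d v (- w) (- v′) w′ ⟩
    (a - b - c + d) + ((v - w) + (w′ - v′))
      ≈⟨ +-congˡ (+-congˡ (⁻¹-anti-homo‿- v′ w′)) ⟨
    (a - b - c + d) + ((v - w) - (v′ - w′)) ∎

  *-distribˡ-alternating : ∀ y a b c d → y * (a - b - c + d) ≈ y * a - y * b - y * c + y * d
  *-distribˡ-alternating y a b c d = begin
    y * (a - b - c + d)
      ≈⟨ solve 5 (λ y a b c d → y :* (a :+ b :+ c :+ d) := y :* a :+ y :* b :+ y :* c :+ y :* d) refl y a (- b) (- c) d ⟩
    y * a + y * - b + y * - c + y * d
      ≈⟨ +-congʳ (+-cong (+-congˡ (-‿distribʳ-* y b)) (-‿distribʳ-* y c)) ⟨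
    y * a - y * b - y * c + y * d ∎

  *-distribˡ-signed : ∀ k y x₀ x₁ x₂ x₃ →
                      y * signed k x₀ x₁ x₂ x₃ ≈ signed k (y * x₀) (y * x₁) (y * x₂) (y * x₃)
  *-distribˡ-signed k y x₀ x₁ x₂ x₃ = trans (*-distribˡ-alternating y _ _ _ _)
    (alternating-cong (swap _ _) (swap _ _) (swap _ _) (swap _ _))
    where
    swap : ∀ a x → y * (a * x) ≈ a * (y * x)
    swap a x = solve 3 (λ y a x → y :* (a :* x) := a :* (y :* x)) refl y a x

  signed-+ : ∀ k x₀ x₁ x₂ x₃ y₀ y₁ y₂ y₃ →
             signed k (x₀ + y₀) (x₁ + y₁) (x₂ + y₂) (x₃ + y₃) ≈ signed k x₀ x₁ x₂ x₃ + signed k y₀ y₁ y₂ y₃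
  signed-+ k x₀ x₁ x₂ x₃ y₀ y₁ y₂ y₃ = trans
    (alternating-cong (distribˡ _ _ _) (distribˡ _ _ _) (distribˡ _ _ _) (distribˡ _ _ _))
    (trans (alternating-+ _ _ _ _ _ _ _ _) (+-congˡ (trans
      (+-congˡ (⁻¹-anti-homo‿- _ _))
      (solve 4 (λ a b c d → (a :+ b) :+ (d :+ c) := a :+ b :+ c :+ d) refl _ _ _ _))))

  signed-0 : ∀ k → signed k 0# 0# 0# 0# ≈ 0#
  signed-0 k = trans (alternating-cong (zeroʳ _) (zeroʳ _) (zeroʳ _) (zeroʳ _))
    (trans (+-identityʳ _) (trans (+-congʳ (-‿inverseʳ 0#)) (-‿inverseʳ 0#)))

  signed-∑ : ∀ k n (f₀ f₁ f₂ f₃ : ℕ → Carrier) →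
             ∑[ i < n ] signed k (f₀ i) (f₁ i) (f₂ i) (f₃ i) ≈ signed k (∑ n f₀) (∑ n f₁) (∑ n f₂) (∑ n f₃)
  signed-∑ k zero    f₀ f₁ f₂ f₃ = sym (signed-0 k)
  signed-∑ k (suc n) f₀ f₁ f₂ f₃ = trans
    (+-congˡ (signed-∑ k n (f₀ ∘ suc) (f₁ ∘ suc) (f₂ ∘ suc) (f₃ ∘ suc)))
    (sym (signed-+ k _ _ _ _ _ _ _ _))

  -- The argument r is the distance between n and ⌊(2n-3j)/2⌋; by the symmetry [2n; n+r] = [2n; n-r]
  -- the negative j also get arguments r ≥ 0.
  schur : ℕ → (ℕ → Carrier) → Carrier
  schur k f = signed k (f (k ℕ.* 3)) (f (1 ℕ.+ k ℕ.* 3)) (f (2 ℕ.+ k ℕ.* 3)) (f (3 ℕ.+ k ℕ.* 3))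

  schur-cong : ∀ k {f g} → (∀ r → f r ≈ g r) → schur k f ≈ schur k g
  schur-cong k f≈g = alternating-cong (*-congˡ (f≈g _)) (*-congˡ (f≈g _)) (*-congˡ (f≈g _)) (*-congˡ (f≈g _))

  -- The k-th groups of terms of Schur's identity for 2n and 2n + 1, divided
  -- by (q;q)₂ₙ and (q;q)₂ₙ₊₁.
  even odd : ℕ → ℕ → Carrier
  even n k = schur k (λ r → W n r (r ℕ.+ n))
  odd n k = signed k (E (k ℕ.* 3)) (E (1 ℕ.+ k ℕ.* 3)) (E (1 ℕ.+ k ℕ.* 3)) (E (2 ℕ.+ k ℕ.* 3))
    where
    E : ℕ → Carrier
    E r = W n r (suc (r ℕ.+ n))

  -- `pascal⁺` is applied at j = 2k, -2k-1 and `pascal⁻` at j = 2k+1, -2k-2. With this choice the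
  -- by-products at 2k and 2k+1 coincide, as do those at -2k-1 and -2k-2, and their signs are
  -- opposite.
  odd→even : ∀ n k → u (suc (n ℕ.+ n)) * odd n k ≈ even n k
  odd→even n k = begin
    w * signed k (E r) (E (1 ℕ.+ r)) (E (1 ℕ.+ r)) (E (2 ℕ.+ r))
      ≈⟨ *-distribˡ-signed k w _ _ _ _ ⟩
    signed k (w * E r) (w * E (1 ℕ.+ r)) (w * E (1 ℕ.+ r)) (w * E (2 ℕ.+ r))
      ≈⟨ alternating-cong
           (trans (step⁺ (ε₀ k) (index n r)) (+-congˡ (*-congʳ (reflexive (≡.cong Q (exponent₀ k n))))))
           (trans (step⁺ (ε₁ k) (index n (1 ℕ.+ r))) (+-congˡ (*-congʳ (reflexive (≡.cong Q (exponent₁ k n))))))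
           (lower (1 ℕ.+ r) _ (exponent₂ k))
           (lower (2 ℕ.+ r) _ (exponent₃ k)) ⟩
    (Q (ε₀ k) * D r + x) - (Q (ε₁ k) * D (1 ℕ.+ r) + y)
      - (Q (ε₂ k) * D (2 ℕ.+ r) + x) + (Q (ε₃ k) * D (3 ℕ.+ r) + y)
      ≈⟨ alternating-+ _ _ _ _ _ _ _ _ ⟩
    even n k + ((x - y) - (x - y))
      ≈⟨ trans (+-congˡ (-‿inverseʳ _)) (+-identityʳ _) ⟩
    even n k ∎
    where
    r = k ℕ.* 3
    w = u (suc (n ℕ.+ n))
    D E : ℕ → Carrier
    D r = W n r (r ℕ.+ n)
    E r = W n r (suc (r ℕ.+ n))
    x = Q (6 ℕ.* (k ℕ.* k) ℕ.+ 4 ℕ.* k ℕ.+ 1 ℕ.+ n) * D (1 ℕ.+ r)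
    y = Q (6 ℕ.* (k ℕ.* k) ℕ.+ 8 ℕ.* k ℕ.+ 3 ℕ.+ n) * D (2 ℕ.+ r)

    index : ∀ n r → suc (n ℕ.+ n) ℕ.+ r ≡ n ℕ.+ suc (r ℕ.+ n)
    index = solve-∀

    exponent₀ : ∀ k n → 6 ℕ.* (k ℕ.* k) ℕ.+ k ℕ.+ suc (k ℕ.* 3 ℕ.+ n) ≡ 6 ℕ.* (k ℕ.* k) ℕ.+ 4 ℕ.* k ℕ.+ 1 ℕ.+ n
    exponent₀ = solve-∀
    exponent₁ : ∀ k n → 6 ℕ.* (k ℕ.* k) ℕ.+ 5 ℕ.* k ℕ.+ 1 ℕ.+ suc (suc (k ℕ.* 3) ℕ.+ n) ≡ 6 ℕ.* (k ℕ.* k) ℕ.+ 8 ℕ.* k ℕ.+ 3 ℕ.+ n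
    exponent₁ = solve-∀
    exponent₂ : ∀ k → 6 ℕ.* (k ℕ.* k) ℕ.+ 7 ℕ.* k ℕ.+ 2 ≡ 6 ℕ.* (k ℕ.* k) ℕ.+ 4 ℕ.* k ℕ.+ 1 ℕ.+ suc (k ℕ.* 3)
    exponent₂ = solve-∀
    exponent₃ : ∀ k → 6 ℕ.* (k ℕ.* k) ℕ.+ 11 ℕ.* k ℕ.+ 5 ≡ 6 ℕ.* (k ℕ.* k) ℕ.+ 8 ℕ.* k ℕ.+ 3 ℕ.+ suc (suc (k ℕ.* 3))
    exponent₃ = solve-∀

    lower : ∀ r a {ε} → ε ≡ a ℕ.+ r → Q ε * (w * E r) ≈ Q ε * D (suc r) + Q (a ℕ.+ n) * D r
    lower r a ≡.refl = step⁻ a (index n r)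

  -- 6k² - 2k.
  ν : ℕ → ℕ
  ν zero    = 0
  ν (suc k) = 6 ℕ.* (k ℕ.* k) ℕ.+ 10 ℕ.* k ℕ.+ 4

  -- The by-products at j = 2k and -2k-1. For k > 0 those at j = 2k-1 and -2k, in the preceding
  -- group, are the same.
  remainder : ℕ → ℕ → Carrier
  remainder n k = Q (ν k ℕ.+ suc n) * W (suc n) (k ℕ.* 3) (k ℕ.* 3 ℕ.+ n)
                  - Q (6 ℕ.* (k ℕ.* k) ℕ.+ 2 ℕ.* k ℕ.+ suc n) * W n (k ℕ.* 3) (suc (k ℕ.* 3 ℕ.+ n))

  -- The choice of rules is opposite to that in `odd→even`, and the by-products now cancel between
  -- neighbouring groups instead of within one.
  even→odd : ∀ n k → u (suc (suc (n ℕ.+ n))) * even (suc n) k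
                       ≈ odd n k + (remainder n k - remainder n (suc k))
  even→odd n k = begin
    w * signed k (W (suc n) r (r ℕ.+ suc n)) (W (suc n) (1 ℕ.+ r) (1 ℕ.+ r ℕ.+ suc n))
                 (W (suc n) (2 ℕ.+ r) (2 ℕ.+ r ℕ.+ suc n)) (W (suc n) (3 ℕ.+ r) (3 ℕ.+ r ℕ.+ suc n))
      ≡⟨ ≡.cong (λ m → w * signed k (W (suc n) r m) (W (suc n) (1 ℕ.+ r) (1 ℕ.+ m))
                         (W (suc n) (2 ℕ.+ r) (2 ℕ.+ m)) (W (suc n) (3 ℕ.+ r) (3 ℕ.+ m))) (ℕ.+-suc r n) ⟩
    w * signed k (D r) (D (1 ℕ.+ r)) (D (2 ℕ.+ r)) (D (3 ℕ.+ r))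
      ≈⟨ *-distribˡ-signed k w _ _ _ _ ⟩
    signed k (w * D r) (w * D (1 ℕ.+ r)) (w * D (2 ℕ.+ r)) (w * D (3 ℕ.+ r))
      ≈⟨ alternating-cong
           (lower r (ν k) (exponent₀ k))
           (lower (1 ℕ.+ r) (6 ℕ.* (k ℕ.* k) ℕ.+ 2 ℕ.* k) (exponent₁ k))
           (trans (step⁺ (ε₂ k) {n = suc n} (index n (2 ℕ.+ r))) (+-congˡ (*-congʳ (reflexive (≡.cong Q (exponent₂ k n))))))
           (trans (step⁺ (ε₃ k) {n = suc n} (index n (3 ℕ.+ r))) (+-congˡ (*-congʳ (reflexive (≡.cong Q (exponent₃ k n)))))) ⟩
    -- `W (suc n) (suc r) m` computes to `W n r m`, so terms at level n + 1 appear as `E`, and the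
    -- last two by-products form `remainder n (suc k)` by definition.
    (Q (ε₀ k) * E r + Q (ν k ℕ.+ suc n) * W (suc n) r (r ℕ.+ n))
      - (Q (ε₁ k) * E (1 ℕ.+ r) + Q (6 ℕ.* (k ℕ.* k) ℕ.+ 2 ℕ.* k ℕ.+ suc n) * E r)
      - (Q (ε₂ k) * E (1 ℕ.+ r) + Q (ν (suc k) ℕ.+ suc n) * E (2 ℕ.+ r))
      + (Q (ε₃ k) * E (2 ℕ.+ r) + Q (6 ℕ.* (suc k ℕ.* suc k) ℕ.+ 2 ℕ.* suc k ℕ.+ suc n) * E (3 ℕ.+ r))
      ≈⟨ alternating-+ _ _ _ _ _ _ _ _ ⟩
    odd n k + (remainder n k - remainder n (suc k)) ∎
    where
    r = k ℕ.* 3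
    w = u (suc (suc (n ℕ.+ n)))
    D E : ℕ → Carrier
    D r = W (suc n) r (suc (r ℕ.+ n))
    E r = W n r (suc (r ℕ.+ n))

    index : ∀ n r → suc (suc (n ℕ.+ n)) ℕ.+ r ≡ suc n ℕ.+ suc (r ℕ.+ n)
    index = solve-∀

    exponent₀ : ∀ k → 6 ℕ.* (k ℕ.* k) ℕ.+ k ≡ ν k ℕ.+ k ℕ.* 3
    exponent₀ zero    = ≡.refl
    exponent₀ (suc k) = expand k
      where
      expand : ∀ k → 6 ℕ.* (suc k ℕ.* suc k) ℕ.+ suc k ≡ 6 ℕ.* (k ℕ.* k) ℕ.+ 10 ℕ.* k ℕ.+ 4 ℕ.+ suc k ℕ.* 3
      expand = solve-∀
    exponent₁ : ∀ k → 6 ℕ.* (k ℕ.* k) ℕ.+ 5 ℕ.* k ℕ.+ 1 ≡ 6 ℕ.* (k ℕ.* k) ℕ.+ 2 ℕ.* k ℕ.+ suc (k ℕ.* 3)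
    exponent₁ = solve-∀
    exponent₂ : ∀ k n → 6 ℕ.* (k ℕ.* k) ℕ.+ 7 ℕ.* k ℕ.+ 2 ℕ.+ suc (suc (suc (k ℕ.* 3)) ℕ.+ n)
                          ≡ 6 ℕ.* (k ℕ.* k) ℕ.+ 10 ℕ.* k ℕ.+ 4 ℕ.+ suc n
    exponent₂ = solve-∀
    exponent₃ : ∀ k n → 6 ℕ.* (k ℕ.* k) ℕ.+ 11 ℕ.* k ℕ.+ 5 ℕ.+ suc (suc (suc (suc (k ℕ.* 3))) ℕ.+ n)
                          ≡ 6 ℕ.* (suc k ℕ.* suc k) ℕ.+ 2 ℕ.* suc k ℕ.+ suc n
    exponent₃ = solve-∀

    lower : ∀ r a {ε} → ε ≡ a ℕ.+ r → Q ε * (w * D r) ≈ Q ε * E r + Q (a ℕ.+ suc n) * W (suc n) r (r ℕ.+ n)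
    lower r a ≡.refl = step⁻ a (index n r)

  -- At k = 0 both halves are qⁿ⁺¹ eₙ eₙ₊₁, with the factors in different order.
  remainder-0 : ∀ n → remainder n 0 ≈ 0#
  remainder-0 n = trans (+-congʳ (*-congˡ (*-comm _ _))) (-‿inverseʳ _)

  remainder-vanish : ∀ {n K} → n ℕ.< K → remainder n K ≈ 0#
  remainder-vanish {n} {K} n<K = trans
    (+-cong (trans (*-congˡ (W-vanish n+1<3K _)) (zeroʳ _))
            (-‿cong (trans (*-congˡ (W-vanish (ℕ.<-trans (ℕ.n<1+n n) n+1<3K) _)) (zeroʳ _))))
    (-‿inverseʳ 0#)
    where
    n+1<3K : suc n ℕ.< K ℕ.* 3
    n+1<3K = ℕ.≤-<-trans n<K (ℕ.m<m*n K 3 ⦃ ℕ.>-nonZero (ℕ.≤-<-trans z≤n n<K) ⦄ (s≤s (s≤s z≤n)))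

  -- Schur's identity for 2n, divided by (q;q)₂ₙ.
  ∑-even : ∀ {K} n → n ℕ.< K → ∑ K (even n) ≈ e (n ℕ.+ n)
  ∑-even {suc K} zero _ = begin
    -- `d 0 r` is 0 for r > 0, so only the term j = 0 survives.
    even 0 0 + ∑ K (even 0 ∘ suc)
      ≈⟨ +-cong (alternating-cong head (0-term 1) (0-term 2) (0-term 5))
                (∑-zero K {even 0 ∘ suc} λ k _ → trans
                  (alternating-cong (0-term (ε₀ (suc k))) (0-term (ε₁ (suc k))) (0-term (ε₂ (suc k))) (0-term (ε₃ (suc k)))) 0-sum) ⟩
    (e 0 - 0# - 0# + 0#) + 0#
      ≈⟨ trans (+-identityʳ _) (trans (+-identityʳ _) (trans (minus-0 _) (minus-0 _))) ⟩
    e 0 ∎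
    where
    minus-0 : ∀ x → x - 0# ≈ x
    minus-0 x = trans (+-congˡ -0#≈0#) (+-identityʳ x)
    0-sum : 0# - 0# - 0# + 0# ≈ 0#
    0-sum = trans (+-identityʳ _) (trans (minus-0 _) (minus-0 _))
    head : Q 0 * (e 0 * e 0) ≈ e 0
    head = trans (*-cong Q-0 (*-congʳ e-0)) (trans (*-identityˡ _) (*-identityˡ _))
    0-term : ∀ ε {x} → Q ε * (0# * x) ≈ 0#
    0-term ε = trans (*-congˡ (zeroˡ _)) (zeroʳ _)
  -- The factors 1 - q²ⁿ⁺² and 1 - q²ⁿ⁺¹ each pay for one half step, and together they reduce e₂ₙ₊₂
  -- to e₂ₙ.
  ∑-even {K} (suc n) n+1<K = u-cancel (suc (n ℕ.+ n)) (u-cancel (n ℕ.+ n) (begin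
    w₁ * (w₂ * ∑ K (even (suc n)))
      ≈⟨ *-congˡ (trans (*-distribˡ-∑ K w₂ (even (suc n))) (∑-cong K (λ k _ → even→odd n k))) ⟩
    w₁ * ∑[ k < K ] (odd n k + (remainder n k - remainder n (suc k)))
      ≈⟨ *-congˡ (trans (∑-+ K (odd n) (λ k → remainder n k - remainder n (suc k))) (+-congˡ (∑-telescope K (remainder n)))) ⟩
    w₁ * (∑ K (odd n) + (remainder n 0 - remainder n K))
      ≈⟨ *-congˡ (+-congˡ (+-cong (remainder-0 n) (-‿cong (remainder-vanish n<K)))) ⟩
    w₁ * (∑ K (odd n) + (0# - 0#))
      ≈⟨ *-congˡ (trans (+-congˡ (-‿inverseʳ 0#)) (+-identityʳ _)) ⟩
    w₁ * ∑ K (odd n)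
      ≈⟨ trans (*-distribˡ-∑ K w₁ (odd n)) (∑-cong K (λ k _ → odd→even n k)) ⟩
    ∑ K (even n)
      ≈⟨ ∑-even n n<K ⟩
    e (n ℕ.+ n)
      ≈⟨ e-suc (n ℕ.+ n) ⟨
    w₁ * e (suc (n ℕ.+ n))
      ≈⟨ *-congˡ (e-suc (suc (n ℕ.+ n))) ⟨
    w₁ * (w₂ * e (suc (suc (n ℕ.+ n))))
      ≡⟨ ≡.cong (λ m → w₁ * (w₂ * e (suc m))) (ℕ.+-suc n n) ⟨
    w₁ * (w₂ * e (suc n ℕ.+ suc n)) ∎))
    where
    w₁ = u (suc (n ℕ.+ n))
    w₂ = u (suc (suc (n ℕ.+ n)))
    n<K = ℕ.<-trans (ℕ.n<1+n n) n+1<K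

  -- The finite form of the theorem

  -- `∑-even` allows any bound above n, so L + 1 serves for all n at once and the double sum ranges
  -- over a rectangle, where the summations can be exchanged.
  finiteIdentity : ∀ L → ∑[ n < suc L ] (Q (n ℕ.* n) * d L n * e (n ℕ.+ n))
                           ≈ ∑[ k < suc L ] schur k (λ r → Q (r ℕ.* r) * W L r (r ℕ.+ L))
  finiteIdentity L = begin
    ∑[ n < suc L ] (x n * e (n ℕ.+ n))
      ≈⟨ ∑-cong (suc L) {λ n → x n * ∑ (suc L) (even n)} (λ n n≤L → *-congˡ (∑-even n n≤L)) ⟨
    ∑[ n < suc L ] (x n * ∑ (suc L) (even n))
      ≈⟨ ∑-cong (suc L) {λ n → x n * ∑ (suc L) (even n)} (λ n _ → *-distribˡ-∑ (suc L) (x n) (even n)) ⟩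
    ∑[ n < suc L ] ∑[ k < suc L ] (x n * even n k)
      ≈⟨ ∑-comm (suc L) (suc L) (λ n k → x n * even n k) ⟩
    ∑[ k < suc L ] ∑[ n < suc L ] (x n * even n k)
      ≈⟨ ∑-cong (suc L) {λ k → ∑[ n < suc L ] (x n * even n k)} (λ k _ → exchange k) ⟩
    ∑[ k < suc L ] schur k (λ r → Q (r ℕ.* r) * W L r (r ℕ.+ L)) ∎
    where
    x : ℕ → Carrier
    x n = Q (n ℕ.* n) * d L n
    X : ℕ → ℕ → Carrier
    X r n = x n * W n r (r ℕ.+ n)

    exchange : ∀ k → ∑[ n < suc L ] (x n * even n k) ≈ schur k (λ r → Q (r ℕ.* r) * W L r (r ℕ.+ L))
    exchange k = begin
      ∑[ n < suc L ] (x n * even n k)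
        ≈⟨ ∑-cong (suc L) {λ n → x n * even n k} (λ n _ → *-distribˡ-signed k (x n) _ _ _ _) ⟩
      ∑[ n < suc L ] schur k (λ r → X r n)
        ≈⟨ signed-∑ k (suc L) (X (k ℕ.* 3)) (X (1 ℕ.+ k ℕ.* 3)) (X (2 ℕ.+ k ℕ.* 3)) (X (3 ℕ.+ k ℕ.* 3)) ⟩
      schur k (λ r → ∑ (suc L) (X r))
        ≈⟨ schur-cong k (baileyLemma L) ⟩
      schur k (λ r → Q (r ℕ.* r) * W L r (r ℕ.+ L)) ∎

-- The ring of power series

open import Data.Integer using (ℤ; +_; _+_; _*_; _-_; -_; -[1+_]; 0ℤ; ∣_∣)
open import Algebra.Properties.Semiring.Sum ℤ.+-*-semiring
  using (sum-cong-≗; ∑-distrib-+; *-distribˡ-sum)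
open ≡ using (refl; sym; trans; cong; cong₂)

module ℤ∑ = SequenceSums ℤ.+-*-semiring

infixl 6 _⊕_

_⊕_ : ℤ⟦q⟧ → ℤ⟦q⟧ → ℤ⟦q⟧
(f ⊕ g) n = f n + g n

⊛-cong : ∀ {f f′ g g′} → f ≋ f′ → g ≋ g′ → f ⊛ g ≋ f′ ⊛ g′
⊛-cong f≋ g≋ n = sum-cong-≗ {suc n} (λ i → cong₂ _*_ (f≋ (toℕ i)) (g≋ (n ∸ toℕ i)))

⊛-distribʳ-⊕ : ∀ h f g → (f ⊕ g) ⊛ h ≋ (f ⊛ h) ⊕ (g ⊛ h)
⊛-distribʳ-⊕ h f g n = trans
  (sum-cong-≗ {suc n} (λ i → ℤ.*-distribʳ-+ (h (n ∸ toℕ i)) (f (toℕ i)) (g (toℕ i))))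
  (∑-distrib-+ {suc n} (λ i → f (toℕ i) * h (n ∸ toℕ i)) (λ i → g (toℕ i) * h (n ∸ toℕ i)))

scale-⊛ : ∀ c f g → (λ m → c * f m) ⊛ g ≋ λ m → c * (f ⊛ g) m
scale-⊛ c f g n = trans
  (sum-cong-≗ {suc n} (λ i → ℤ.*-assoc c (f (toℕ i)) (g (n ∸ toℕ i))))
  (sym (*-distribˡ-sum {suc n} c (λ i → f (toℕ i) * g (n ∸ toℕ i))))

-- By computation, the tail of f ⊛ g is f₀ times the tail of g plus the tail of f times g; this
-- drives an induction on the coefficient, for all series at once.
⊛-assoc : ∀ f g h → (f ⊛ g) ⊛ h ≋ f ⊛ (g ⊛ h)
⊛-assoc f g h zero = solve 3 (λ a b c → (a :* b :+ con 0ℤ) :* c :+ con 0ℤ := a :* (b :* c :+ con 0ℤ) :+ con 0ℤ)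
  refl (f 0) (g 0) (h 0)
  where open +-*-Solver
⊛-assoc f g h (suc n) = begin
  (f 0 * g 0 + 0ℤ) * h (suc n) + (((λ m → f 0 * g (suc m)) ⊕ (f ∘ suc ⊛ g)) ⊛ h) n
    ≡⟨ cong (λ x → c + x) (⊛-distribʳ-⊕ h (λ m → f 0 * g (suc m)) (f ∘ suc ⊛ g) n) ⟩
  c + (((λ m → f 0 * g (suc m)) ⊛ h) n + ((f ∘ suc ⊛ g) ⊛ h) n)
    ≡⟨ cong (λ x → c + x) (cong₂ _+_ (scale-⊛ (f 0) (g ∘ suc) h n) (⊛-assoc (f ∘ suc) g h n)) ⟩
  (f 0 * g 0 + 0ℤ) * h (suc n) + (f 0 * (g ∘ suc ⊛ h) n + (f ∘ suc ⊛ (g ⊛ h)) n)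
    ≡⟨ solve 5 (λ a b c d e → (a :* b :+ con 0ℤ) :* c :+ (a :* d :+ e) := a :* (b :* c :+ d) :+ e)
         refl (f 0) (g 0) (h (suc n)) ((g ∘ suc ⊛ h) n) ((f ∘ suc ⊛ (g ⊛ h)) n) ⟩
  f 0 * (g 0 * h (suc n) + (g ∘ suc ⊛ h) n) + (f ∘ suc ⊛ (g ⊛ h)) n ∎
  where
  open ≡.≡-Reasoning
  open +-*-Solver
  c = (f 0 * g 0 + 0ℤ) * h (suc n)

-- The convolution unfolds from its first term only; splitting off the last one is what
-- commutativity needs.
⊛-sucʳ : ∀ f g n → (f ⊛ g) (suc n) ≡ (f ⊛ (g ∘ suc)) n + f (suc n) * g 0
⊛-sucʳ f g zero = solve 4 (λ a b c d → a :* b :+ (c :* d :+ con 0ℤ) := a :* b :+ con 0ℤ :+ c :* d)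
  refl (f 0) (g 1) (f 1) (g 0)
  where open +-*-Solver
⊛-sucʳ f g (suc n) = trans (cong (λ x → f 0 * g (2 ℕ.+ n) + x) (⊛-sucʳ (f ∘ suc) g n))
  (sym (ℤ.+-assoc (f 0 * g (2 ℕ.+ n)) ((f ∘ suc ⊛ (g ∘ suc)) n) (f (2 ℕ.+ n) * g 0)))

⊛-comm : ∀ f g → f ⊛ g ≋ g ⊛ f
⊛-comm f g zero    = cong (_+ 0ℤ) (ℤ.*-comm (f 0) (g 0))
⊛-comm f g (suc n) = begin
  f 0 * g (suc n) + (f ∘ suc ⊛ g) n    ≡⟨ cong₂ _+_ (ℤ.*-comm (f 0) (g (suc n))) (⊛-comm (f ∘ suc) g n) ⟩
  g (suc n) * f 0 + (g ⊛ (f ∘ suc)) n  ≡⟨ ℤ.+-comm (g (suc n) * f 0) _ ⟩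
  (g ⊛ (f ∘ suc)) n + g (suc n) * f 0  ≡⟨ ⊛-sucʳ g f n ⟨
  (g ⊛ f) (suc n)                      ∎
  where open ≡.≡-Reasoning

0-⊛ : ∀ f n → ((λ _ → 0ℤ) ⊛ f) n ≡ 0ℤ
-- `0ℤ * x` computes to `0ℤ`, so distributivity of the factor 0 is already the claim.
0-⊛ f n = sym (*-distribˡ-sum {suc n} 0ℤ (λ i → f (n ∸ toℕ i)))

𝟙-⊛ : ∀ f → 𝟙 ⊛ f ≋ f
𝟙-⊛ f zero    = trans (ℤ.+-identityʳ _) (ℤ.*-identityˡ _)
𝟙-⊛ f (suc n) = trans (cong₂ _+_ (ℤ.*-identityˡ (f (suc n))) (0-⊛ f n)) (ℤ.+-identityʳ _)

seriesRing : CommutativeRing 0ℓ 0ℓ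
seriesRing = record
  { Carrier = ℤ⟦q⟧
  ; _≈_ = _≋_
  ; _+_ = _⊕_
  ; _*_ = _⊛_
  ; -_ = λ f n → - f n
  ; 0# = λ _ → 0ℤ
  ; 1# = 𝟙
  ; isCommutativeRing = record
    { isRing = record
      { +-isAbelianGroup = AbelianGroup.isAbelianGroup (abelianGroup ℕ ℤ.+-0-abelianGroup)
      ; *-cong = ⊛-cong
      ; *-assoc = ⊛-assoc
      ; *-identity = 𝟙-⊛ , (λ f n → trans (⊛-comm f 𝟙 n) (𝟙-⊛ f n))
      ; distrib = (λ h f g n → trans (⊛-comm h (f ⊕ g) n)
                    (trans (⊛-distribʳ-⊕ h f g n) (cong₂ _+_ (⊛-comm f h n) (⊛-comm g h n))))
                , ⊛-distribʳ-⊕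
      }
    ; *-comm = ⊛-comm
    }
  }

-- Powers of q as series

q^-suc : ∀ e n → (q^ suc e) (suc n) ≡ (q^ e) n
q^-suc e n with e ℕ.≟ n | suc e ℕ.≟ suc n
... | yes _   | yes _     = refl
... | no _    | no _      = refl
... | yes e≡n | no e≢n    = contradiction (cong suc e≡n) e≢n
... | no e≢n  | yes e≡n   = contradiction (ℕ.suc-injective e≡n) e≢n

q^-vanish : ∀ {e n} → n ℕ.< e → (q^ e) n ≡ 0ℤ
q^-vanish {e} {n} n<e with e ℕ.≟ n
... | yes refl = contradiction n<e (ℕ.<-irrefl refl)
... | no _     = refl

q^-⊛-suc : ∀ e f n → (q^ suc e ⊛ f) (suc n) ≡ (q^ e ⊛ f) n
q^-⊛-suc e f n = trans (ℤ.+-identityˡ _) (⊛-cong {g = f} (q^-suc e) (λ _ → refl) n)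

q^-+ : ∀ m n → q^ (m ℕ.+ n) ≋ q^ m ⊛ q^ n
q^-+ zero    n k       = sym (𝟙-⊛ (q^ n) k)
q^-+ (suc m) n zero    = refl
q^-+ (suc m) n (suc k) = trans (q^-suc (m ℕ.+ n) k) (trans (q^-+ m n k) (sym (q^-⊛-suc m (q^ n) k)))

q^-⊛-vanish : ∀ {e n} f → n ℕ.< e → (q^ e ⊛ f) n ≡ 0ℤ
q^-⊛-vanish {suc e} {zero}  f _         = refl
q^-⊛-vanish {suc e} {suc n} f (s≤s n<e) = trans (q^-⊛-suc e f n) (q^-⊛-vanish f n<e)

qFactorial : QFactorial seriesRing
qFactorial = record
  { Q     = q^_
  ; p     = qPoch
  ; e     = λ n → qPoch n ⁻¹
  ; Q-0   = λ _ → refl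
  ; Q-+   = q^-+
  ; p-0   = λ _ → refl
  ; p-suc = λ _ _ → refl
  ; p*e≈1 = λ n → ⁻¹-inverseʳ (qPoch n) (qPoch-constantTerm n)
  }

module Series = CommutativeRing seriesRing
import Algebra.Solver.Ring.NaturalCoefficients.Default Series.commutativeSemiring as SeriesSolver
open SequenceSums Series.semiring
open BaileyPair seriesRing qFactorial
  using (d; d-diagonal; W; ε₀; ε₁; ε₂; ε₃; schur; *-distribˡ-signed; finiteIdentity)

∑-coefficient : ∀ K f n → ∑ K f n ≡ ℤ∑.∑ K (λ k → f k n)
∑-coefficient zero    f n = refl
∑-coefficient (suc K) f n = cong (λ x → f 0 n + x) (∑-coefficient K (f ∘ suc) n)

-- Congruence modulo q^N

infix 4 _≈[_]_

_≈[_]_ : ℤ⟦q⟧ → ℕ → ℤ⟦q⟧ → Set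
f ≈[ N ] g = ∀ n → n ℕ.< N → f n ≡ g n

≈[]-setoid : ℕ → Setoid 0ℓ 0ℓ
≈[]-setoid N = record
  { Carrier = ℤ⟦q⟧
  ; _≈_ = _≈[ N ]_
  ; isEquivalence = record
    { refl  = λ _ _ → refl
    ; sym   = λ f≈g n n<N → sym (f≈g n n<N)
    ; trans = λ f≈g g≈h n n<N → trans (f≈g n n<N) (g≈h n n<N)
    }
  }

≋⇒≈[] : ∀ {f g N} → f ≋ g → f ≈[ N ] g
≋⇒≈[] f≋g n _ = f≋g n

≈[]-weaken : ∀ {f g M N} → M ℕ.≤ N → f ≈[ N ] g → f ≈[ M ] g
≈[]-weaken M≤N f≈g n n<M = f≈g n (ℕ.<-≤-trans n<M M≤N)

⊛-cong-≈[] : ∀ {N f f′ g g′} → f ≈[ N ] f′ → g ≈[ N ] g′ → f ⊛ g ≈[ N ] f′ ⊛ g′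
⊛-cong-≈[] f≈ g≈ n n<N = sum-cong-≗ {suc n} λ i →
  cong₂ _*_ (f≈ (toℕ i) (ℕ.≤-<-trans (ℕ.≤-pred (toℕ<n i)) n<N)) (g≈ (n ∸ toℕ i) (ℕ.≤-<-trans (ℕ.m∸n≤m n (toℕ i)) n<N))

-- This gain in precision offsets the loss from replacing (q;q)_L by (q;q)_(L-r).
q^-⊛-≈[] : ∀ e {N f g} → f ≈[ N ] g → q^ e ⊛ f ≈[ e ℕ.+ N ] q^ e ⊛ g
q^-⊛-≈[] zero    {f = f} {g} f≈g n n<N = trans (𝟙-⊛ f n) (trans (f≈g n n<N) (sym (𝟙-⊛ g n)))
q^-⊛-≈[] (suc e) f≈g zero    _           = refl
q^-⊛-≈[] (suc e) {f = f} {g} f≈g (suc n) (s≤s n<e+N) =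
  trans (q^-⊛-suc e f n) (trans (q^-⊛-≈[] e f≈g n n<e+N) (sym (q^-⊛-suc e g n)))

∑-cong-≈[] : ∀ K {N f g} → (∀ k → f k ≈[ N ] g k) → ∑ K f ≈[ N ] ∑ K g
∑-cong-≈[] K {f = f} {g} f≈g n n<N = trans (∑-coefficient K f n)
  (trans (ℤ∑.∑-cong K (λ k _ → f≈g k n n<N)) (sym (∑-coefficient K g n)))

schur-cong-≈[] : ∀ k {N f g} → (∀ r → f r ≈[ N ] g r) → schur k f ≈[ N ] schur k g
schur-cong-≈[] k {N} {f} {g} f≈g n n<N = cong₂ _+_ (cong₂ _-_ (cong₂ _-_ (term (ε₀ k) (k ℕ.* 3))
  (term (ε₁ k) (1 ℕ.+ k ℕ.* 3))) (term (ε₂ k) (2 ℕ.+ k ℕ.* 3))) (term (ε₃ k) (3 ℕ.+ k ℕ.* 3))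
  where
  term : ∀ ε r → (q^ ε ⊛ f r) n ≡ (q^ ε ⊛ g r) n
  term ε r = ⊛-cong-≈[] {f = q^ ε} (λ _ _ → refl) (f≈g r) n n<N

⊛-inverse-≈[] : ∀ {N f g x y} → f ⊛ x ≋ 𝟙 → g ⊛ y ≋ 𝟙 → f ≈[ N ] g → x ≈[ N ] y
⊛-inverse-≈[] {N} {f} {g} {x} {y} fx≋1 gy≋1 f≈g = begin
  x              ≈⟨ ≋⇒≈[] (Series.*-identityʳ x) ⟨
  x ⊛ 𝟙          ≈⟨ ≋⇒≈[] (Series.*-congˡ {x} gy≋1) ⟨
  x ⊛ (g ⊛ y)    ≈⟨ ⊛-cong-≈[] {f = x} (λ _ _ → refl) (⊛-cong-≈[] {g = y} f≈g (λ _ _ → refl)) ⟨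
  x ⊛ (f ⊛ y)    ≈⟨ ≋⇒≈[] (solve 3 (λ x f y → x :* (f :* y) := (f :* x) :* y) Series.refl x f y) ⟩
  (f ⊛ x) ⊛ y    ≈⟨ ≋⇒≈[] (Series.*-congʳ {y} fx≋1) ⟩
  𝟙 ⊛ y          ≈⟨ ≋⇒≈[] (𝟙-⊛ y) ⟩
  y              ∎
  where
  open SetoidReasoning (≈[]-setoid N)
  open SeriesSolver

-- Convergence of (q;q)ₙ

qPoch-≈[] : ∀ o m → qPoch (o ℕ.+ m) ≈[ suc m ] qPoch m
qPoch-≈[] zero    m = λ _ _ → refl
qPoch-≈[] (suc o) m = begin
  qPoch (o ℕ.+ m) ⊛ (𝟙 ⊖ q^ suc (o ℕ.+ m))   ≈⟨ ⊛-cong-≈[] (qPoch-≈[] o m) factor≈1 ⟩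
  qPoch m ⊛ 𝟙                                ≈⟨ ≋⇒≈[] (Series.*-identityʳ (qPoch m)) ⟩
  qPoch m                                    ∎
  where
  open SetoidReasoning (≈[]-setoid (suc m))
  factor≈1 : 𝟙 ⊖ q^ suc (o ℕ.+ m) ≈[ suc m ] 𝟙
  factor≈1 n n≤m = trans (cong (λ x → 𝟙 n - x) (q^-vanish (ℕ.<-≤-trans n≤m (s≤s (ℕ.m≤n+m m o))))) (ℤ.+-identityʳ (𝟙 n))

-- The diagonal suffices, since factors 1 - qʲ with j > n do not affect coefficient n.
qPoch∞ : ℤ⟦q⟧
qPoch∞ n = qPoch n n

qPoch⟶qPoch∞ : qPoch ⟶ qPoch∞
qPoch⟶qPoch∞ n = n , λ m n≤m → trans
  (cong (λ m → qPoch m n) (sym (ℕ.m∸n+n≡m n≤m))) (qPoch-≈[] (m ∸ n) n n (ℕ.n<1+n n))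

qPoch⁻¹≈qPoch∞⁻¹ : ∀ m → qPoch m ⁻¹ ≈[ suc m ] qPoch∞ ⁻¹
qPoch⁻¹≈qPoch∞⁻¹ m = ⊛-inverse-≈[] (⁻¹-inverseʳ (qPoch m) (qPoch-constantTerm m)) (⁻¹-inverseʳ qPoch∞ refl)
  λ { n (s≤s n≤m) → proj₂ (qPoch⟶qPoch∞ n) m n≤m }

-- (q;q)_L / (q;q)_(L-r) is 1 modulo q^(L-r+1).
q^-⊛-quotient : ∀ {a r} L → r ℕ.≤ a → q^ a ⊛ (qPoch L ⊛ d L r) ≈[ suc L ] q^ a
q^-⊛-quotient {a} {r} L r≤a with ℕ.≤-<-connex r L
-- Here a ≥ r > L, so both sides are 0 modulo q^(L+1).
... | inj₂ L<r = λ { n (s≤s n≤L) →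
  let n<a = ℕ.≤-<-trans n≤L (ℕ.<-≤-trans L<r r≤a) in
  trans (q^-⊛-vanish (qPoch L ⊛ d L r) n<a) (sym (q^-vanish n<a)) }
... | inj₁ r≤L with ℕ.m≤n⇒∃[o]m+o≡n r≤L
-- The quotient is known only modulo q^(M+1), with L = r+M; the factor qᵃ raises this to a+M+1 ≥
-- L+1.
...   | M , refl = ≈[]-weaken bound (begin
  q^ a ⊛ (qPoch (r ℕ.+ M) ⊛ d (r ℕ.+ M) r)  ≡⟨ cong (λ x → q^ a ⊛ (qPoch (r ℕ.+ M) ⊛ x)) (d-diagonal r M) ⟩
  q^ a ⊛ (qPoch (r ℕ.+ M) ⊛ qPoch M ⁻¹)     ≈⟨ q^-⊛-≈[] a (⊛-cong-≈[] {g = qPoch M ⁻¹} (qPoch-≈[] r M) (λ _ _ → refl)) ⟩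
  q^ a ⊛ (qPoch M ⊛ qPoch M ⁻¹)             ≈⟨ ≋⇒≈[] (Series.*-congˡ {q^ a} (⁻¹-inverseʳ (qPoch M) (qPoch-constantTerm M))) ⟩
  q^ a ⊛ 𝟙                                  ≈⟨ ≋⇒≈[] (Series.*-identityʳ (q^ a)) ⟩
  q^ a                                      ∎)
  where
  open SetoidReasoning (≈[]-setoid (a ℕ.+ suc M))
  bound : suc (r ℕ.+ M) ℕ.≤ a ℕ.+ suc M
  bound = ℕ.≤-trans (ℕ.≤-reflexive (sym (ℕ.+-suc r M))) (ℕ.+-monoˡ-≤ (suc M) r≤a)

-- Both sides modulo q^(L+1)

n≤n*n : ∀ n → n ℕ.≤ n ℕ.* n
n≤n*n zero    = z≤n
n≤n*n (suc n) = ℕ.m≤m*n (suc n) (suc n)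

summand : ℕ → ℤ⟦q⟧
summand n = q^ (n ^ℕ 2) ⊛ qPoch (2 *ℕ n) ⁻¹

summandℤ : ℤ → ℤ⟦q⟧
summandℤ k = q^⟨ + 15 * (k * k) + k , 15k²+k≥0 k ⟩ ⊖ q^⟨ + 15 * (k * k) + + 11 * k + + 2 , 15k²+11k+2≥0 k ⟩

∑-summand : ∀ L → ∑ (suc L) summand ≈[ suc L ]
                  qPoch L ⊛ ∑[ n < suc L ] (q^ (n ℕ.* n) ⊛ d L n ⊛ qPoch (n ℕ.+ n) ⁻¹)
∑-summand L = begin
  ∑ (suc L) summand
    ≈⟨ ∑-cong-≈[] (suc L) term ⟩
  ∑[ n < suc L ] (qPoch L ⊛ t n)
    ≈⟨ ≋⇒≈[] (*-distribˡ-∑ (suc L) (qPoch L) t) ⟨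
  qPoch L ⊛ ∑ (suc L) t ∎
  where
  open SetoidReasoning (≈[]-setoid (suc L))
  t : ℕ → ℤ⟦q⟧
  t n = q^ (n ℕ.* n) ⊛ d L n ⊛ qPoch (n ℕ.+ n) ⁻¹
  term : ∀ n → summand n ≈[ suc L ] qPoch L ⊛ t n
  term n = begin
    q^ (n ^ℕ 2) ⊛ qPoch (2 *ℕ n) ⁻¹
      ≡⟨ cong₂ (λ a b → q^ (n ℕ.* a) ⊛ qPoch (n ℕ.+ b) ⁻¹) (ℕ.*-identityʳ n) (ℕ.+-identityʳ n) ⟩
    q^ (n ℕ.* n) ⊛ e
      ≈⟨ ⊛-cong-≈[] {g = e} (q^-⊛-quotient L (n≤n*n n)) (λ _ _ → refl) ⟨
    q^ (n ℕ.* n) ⊛ (qPoch L ⊛ d L n) ⊛ e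
      ≈⟨ ≋⇒≈[] (solve 4 (λ a p d e → a :* (p :* d) :* e := p :* (a :* d :* e)) Series.refl (q^ (n ℕ.* n)) (qPoch L) (d L n) e) ⟩
    qPoch L ⊛ t n ∎
    where
    open SeriesSolver
    e = qPoch (n ℕ.+ n) ⁻¹

-- Of the two denominators in `W`, (q;q)_L cancels (q;q)_(L-r) with the help of q^(r²), while
-- 1/(q;q)_(L+r) already agrees with 1/(q;q)_∞ to this precision.
∑-schur : ∀ L → qPoch L ⊛ ∑[ k < suc L ] schur k (λ r → q^ (r ℕ.* r) ⊛ W L r (r ℕ.+ L)) ≈[ suc L ]
                qPoch∞ ⁻¹ ⊛ ∑[ k < suc L ] schur k (λ r → q^ (r ℕ.* r))
∑-schur L = begin
  qPoch L ⊛ ∑[ k < suc L ] schur k t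
    ≈⟨ ≋⇒≈[] (*-distribˡ-∑ (suc L) (qPoch L) (λ k → schur k t)) ⟩
  ∑[ k < suc L ] (qPoch L ⊛ schur k t)
    ≈⟨ ∑-cong-≈[] (suc L) group ⟩
  ∑[ k < suc L ] (qPoch∞ ⁻¹ ⊛ schur k square)
    ≈⟨ ≋⇒≈[] (*-distribˡ-∑ (suc L) (qPoch∞ ⁻¹) (λ k → schur k square)) ⟨
  qPoch∞ ⁻¹ ⊛ ∑[ k < suc L ] schur k square ∎
  where
  open SetoidReasoning (≈[]-setoid (suc L))
  square t : ℕ → ℤ⟦q⟧
  square r = q^ (r ℕ.* r)
  t r = square r ⊛ W L r (r ℕ.+ L)
  term : ∀ r → qPoch L ⊛ t r ≈[ suc L ] qPoch∞ ⁻¹ ⊛ square r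
  term r = begin
    qPoch L ⊛ (square r ⊛ (d L r ⊛ e))
      ≈⟨ ≋⇒≈[] (solve 4 (λ p a d e → p :* (a :* (d :* e)) := e :* (a :* (p :* d))) Series.refl (qPoch L) (square r) (d L r) e) ⟩
    e ⊛ (square r ⊛ (qPoch L ⊛ d L r))
      ≈⟨ ⊛-cong-≈[] (≈[]-weaken (s≤s (ℕ.m≤n+m L r)) (qPoch⁻¹≈qPoch∞⁻¹ (r ℕ.+ L))) (q^-⊛-quotient L (n≤n*n r)) ⟩
    qPoch∞ ⁻¹ ⊛ square r ∎
    where
    open SeriesSolver
    e = qPoch (r ℕ.+ L) ⁻¹
  group : ∀ k → qPoch L ⊛ schur k t ≈[ suc L ] qPoch∞ ⁻¹ ⊛ schur k square
  group k = begin
    qPoch L ⊛ schur k t                    ≈⟨ ≋⇒≈[] (*-distribˡ-signed k (qPoch L) _ _ _ _) ⟩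
    schur k (λ r → qPoch L ⊛ t r)          ≈⟨ schur-cong-≈[] k term ⟩
    schur k (λ r → qPoch∞ ⁻¹ ⊛ square r)   ≈⟨ ≋⇒≈[] (*-distribˡ-signed k (qPoch∞ ⁻¹) _ _ _ _) ⟨
    qPoch∞ ⁻¹ ⊛ schur k square             ∎

-- Terms of the bilateral sum

+-quadratic : ∀ a b c n → + (a ℕ.* (n ℕ.* n) ℕ.+ b ℕ.* n ℕ.+ c) ≡ + a * (+ n * + n) + + b * + n + + c
+-quadratic a b c n = cong (_+ + c) (cong₂ _+_
  (trans (ℤ.pos-* a (n ℕ.* n)) (cong (+ a *_) (ℤ.pos-* n n))) (ℤ.pos-* b n))

-- The redundant 1 and 0 keep the exponent in the shape shared by `+-quadratic` and `n≤quadratic`.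
summandℤ-pos : ∀ k → summandℤ (+ k) ≡ q^ (15 ℕ.* (k ℕ.* k) ℕ.+ 1 ℕ.* k ℕ.+ 0) ⊖ q^ (15 ℕ.* (k ℕ.* k) ℕ.+ 11 ℕ.* k ℕ.+ 2)
summandℤ-pos k = sym (cong₂ (λ i j → q^ ∣ i ∣ ⊖ q^ ∣ j ∣)
  (trans (+-quadratic 15 1 0 k)
    (solve 1 (λ x → con (+ 15) :* (x :* x) :+ con (+ 1) :* x :+ con (+ 0) := con (+ 15) :* (x :* x) :+ x) refl (+ k)))
  (+-quadratic 15 11 2 k))
  where open +-*-Solver

summandℤ-neg : ∀ k → summandℤ -[1+ k ] ≡ q^ (15 ℕ.* (k ℕ.* k) ℕ.+ 29 ℕ.* k ℕ.+ 14) ⊖ q^ (15 ℕ.* (k ℕ.* k) ℕ.+ 19 ℕ.* k ℕ.+ 6)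
summandℤ-neg k = sym (cong₂ (λ i j → q^ ∣ i ∣ ⊖ q^ ∣ j ∣)
  (trans (+-quadratic 15 29 14 k)
    (solve 1 (λ x → let y = :- (con (+ 1) :+ x) in con (+ 15) :* (x :* x) :+ con (+ 29) :* x :+ con (+ 14)
      := con (+ 15) :* (y :* y) :+ y) refl (+ k)))
  (trans (+-quadratic 15 19 6 k)
    (solve 1 (λ x → let y = :- (con (+ 1) :+ x) in con (+ 15) :* (x :* x) :+ con (+ 19) :* x :+ con (+ 6)
      := con (+ 15) :* (y :* y) :+ con (+ 11) :* y :+ con (+ 2)) refl (+ k))))
  where open +-*-Solver

-- The exponents r² at r = 3k + i complete those of Schur's identity to the
-- exponents at k and at -k-1.
schur-squares : ∀ k → schur k (λ r → q^ (r ℕ.* r)) ≋ summandℤ (+ k) ⊕ summandℤ -[1+ k ]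
schur-squares k n = begin
  schur k (λ r → q^ (r ℕ.* r)) n
    ≡⟨ cong₂ _+_ (cong₂ _-_ (cong₂ _-_ (merge (ε₀ k) _ (exponent₀ k)) (merge (ε₁ k) _ (exponent₁ k)))
         (merge (ε₂ k) _ (exponent₂ k))) (merge (ε₃ k) _ (exponent₃ k)) ⟩
  a - b - c + d′
    ≡⟨ solve 4 (λ a b c d → a :+ :- b :+ :- c :+ d := (a :+ :- b) :+ (d :+ :- c)) refl a b c d′ ⟩
  (a - b) + (d′ - c)
    ≡⟨ cong₂ (λ f g → f n + g n) (summandℤ-pos k) (summandℤ-neg k) ⟨
  (summandℤ (+ k) ⊕ summandℤ -[1+ k ]) n ∎
  where
  open ≡.≡-Reasoning
  open +-*-Solver
  a = (q^ (15 ℕ.* (k ℕ.* k) ℕ.+ 1 ℕ.* k ℕ.+ 0)) n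
  b = (q^ (15 ℕ.* (k ℕ.* k) ℕ.+ 11 ℕ.* k ℕ.+ 2)) n
  c = (q^ (15 ℕ.* (k ℕ.* k) ℕ.+ 19 ℕ.* k ℕ.+ 6)) n
  d′ = (q^ (15 ℕ.* (k ℕ.* k) ℕ.+ 29 ℕ.* k ℕ.+ 14)) n

  merge : ∀ i j {m} → i ℕ.+ j ≡ m → (q^ i ⊛ q^ j) n ≡ (q^ m) n
  merge i j refl = sym (q^-+ i j n)

  exponent₀ : ∀ k → 6 ℕ.* (k ℕ.* k) ℕ.+ k ℕ.+ (k ℕ.* 3) ℕ.* (k ℕ.* 3) ≡ 15 ℕ.* (k ℕ.* k) ℕ.+ 1 ℕ.* k ℕ.+ 0
  exponent₀ = solve-∀
  exponent₁ : ∀ k → 6 ℕ.* (k ℕ.* k) ℕ.+ 5 ℕ.* k ℕ.+ 1 ℕ.+ (1 ℕ.+ k ℕ.* 3) ℕ.* (1 ℕ.+ k ℕ.* 3) ≡ 15 ℕ.* (k ℕ.* k) ℕ.+ 11 ℕ.* k ℕ.+ 2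
  exponent₁ = solve-∀
  exponent₂ : ∀ k → 6 ℕ.* (k ℕ.* k) ℕ.+ 7 ℕ.* k ℕ.+ 2 ℕ.+ (2 ℕ.+ k ℕ.* 3) ℕ.* (2 ℕ.+ k ℕ.* 3) ≡ 15 ℕ.* (k ℕ.* k) ℕ.+ 19 ℕ.* k ℕ.+ 6
  exponent₂ = solve-∀
  exponent₃ : ∀ k → 6 ℕ.* (k ℕ.* k) ℕ.+ 11 ℕ.* k ℕ.+ 5 ℕ.+ (3 ℕ.+ k ℕ.* 3) ℕ.* (3 ℕ.+ k ℕ.* 3) ≡ 15 ℕ.* (k ℕ.* k) ℕ.+ 29 ℕ.* k ℕ.+ 14
  exponent₃ = solve-∀

-- Convergence of the sums and passage to the limit

n≤quadratic : ∀ a b c .⦃ _ : ℕ.NonZero b ⦄ n → n ℕ.≤ a ℕ.* (n ℕ.* n) ℕ.+ b ℕ.* n ℕ.+ c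
n≤quadratic a b c n = ℕ.≤-trans (ℕ.m≤n*m n b) (ℕ.≤-trans (ℕ.m≤n+m _ (a ℕ.* (n ℕ.* n))) (ℕ.m≤m+n _ c))

⊖-q^-vanish : ∀ {i j n} → n ℕ.< i → n ℕ.< j → (q^ i ⊖ q^ j) n ≡ 0ℤ
⊖-q^-vanish n<i n<j = cong₂ _-_ (q^-vanish n<i) (q^-vanish n<j)

summand-vanish : ∀ {n k} → n ℕ.< k → summand k n ≡ 0ℤ
summand-vanish {n} {k} n<k = q^-⊛-vanish (qPoch (2 *ℕ k) ⁻¹)
  (ℕ.<-≤-trans n<k (ℕ.≤-trans (n≤n*n k) (ℕ.≤-reflexive (cong (k ℕ.*_) (sym (ℕ.*-identityʳ k))))))

summandℤ-pos-vanish : ∀ {n k} → n ℕ.< k → summandℤ (+ k) n ≡ 0ℤ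
summandℤ-pos-vanish {n} {k} n<k = trans (cong (λ f → f n) (summandℤ-pos k))
  (⊖-q^-vanish (ℕ.<-≤-trans n<k (n≤quadratic 15 1 0 k)) (ℕ.<-≤-trans n<k (n≤quadratic 15 11 2 k)))

summandℤ-neg-vanish : ∀ {n k} → n ℕ.< k → summandℤ -[1+ k ] n ≡ 0ℤ
summandℤ-neg-vanish {n} {k} n<k = trans (cong (λ f → f n) (summandℤ-neg k))
  (⊖-q^-vanish (ℕ.<-≤-trans n<k (n≤quadratic 15 29 14 k)) (ℕ.<-≤-trans n<k (n≤quadratic 15 19 6 k)))

-- The k-th summand is divisible by qᵏ, so coefficient n is settled by the indices up to n.
series : ℤ⟦q⟧
series n = ℤ∑.∑ (suc n) (λ k → summand k n)

seriesℤ : ℤ⟦q⟧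
seriesℤ n = ℤ∑.∑ (suc n) (λ k → summandℤ -[1+ k ] n) + ℤ∑.∑ (suc n) (λ k → summandℤ (+ k) n)

hasSum : HasSum summand series
hasSum n = suc n , λ N n<N → ℤ∑.∑-truncate (λ k → summand k n) n<N (λ _ → summand-vanish)

hasSumℤ : HasSumℤ summandℤ seriesℤ
hasSumℤ n = suc n , λ M N n<M n<N → cong₂ _+_
  (ℤ∑.∑-truncate (λ k → summandℤ -[1+ k ] n) n<M (λ _ → summandℤ-neg-vanish))
  (ℤ∑.∑-truncate (λ k → summandℤ (+ k) n) n<N (λ _ → summandℤ-pos-vanish))

-- Each group of four contributes the terms k and -k-1, so L + 1 groups make up the symmetric
-- partial sum, which is stable up to coefficient L.
seriesℤ≈ : ∀ L → seriesℤ ≈[ suc L ] ∑[ k < suc L ] schur k (λ r → q^ (r ℕ.* r))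
seriesℤ≈ L n n≤L = sym (begin
  ∑ (suc L) (λ k → schur k (λ r → q^ (r ℕ.* r))) n
    ≡⟨ ∑-coefficient (suc L) (λ k → schur k (λ r → q^ (r ℕ.* r))) n ⟩
  ℤ∑.∑ (suc L) (λ k → schur k (λ r → q^ (r ℕ.* r)) n)
    ≡⟨ ℤ∑.∑-cong (suc L) (λ k _ → trans (schur-squares k n) (ℤ.+-comm (summandℤ (+ k) n) _)) ⟩
  ℤ∑.∑ (suc L) (λ k → summandℤ -[1+ k ] n + summandℤ (+ k) n)
    ≡⟨ ℤ∑.∑-+ (suc L) (λ k → summandℤ -[1+ k ] n) (λ k → summandℤ (+ k) n) ⟩
  ℤ∑.∑ (suc L) (λ k → summandℤ -[1+ k ] n) + ℤ∑.∑ (suc L) (λ k → summandℤ (+ k) n)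
    ≡⟨ proj₂ (hasSumℤ n) (suc L) (suc L) n≤L n≤L ⟩
  seriesℤ n ∎)
  where open ≡.≡-Reasoning

series≋ : series ≋ qPoch∞ ⁻¹ ⊛ seriesℤ
-- Coefficient L is taken from the finite identity with the same L; precision q^(L+1) just includes
-- it.
series≋ L = trans (sym (∑-coefficient (suc L) summand L)) ((begin
  ∑ (suc L) summand
    ≈⟨ ∑-summand L ⟩
  qPoch L ⊛ ∑[ n < suc L ] (q^ (n ℕ.* n) ⊛ d L n ⊛ qPoch (n ℕ.+ n) ⁻¹)
    ≈⟨ ≋⇒≈[] (Series.*-congˡ {qPoch L} (finiteIdentity L)) ⟩
  qPoch L ⊛ ∑[ k < suc L ] schur k (λ r → q^ (r ℕ.* r) ⊛ W L r (r ℕ.+ L))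
    ≈⟨ ∑-schur L ⟩
  qPoch∞ ⁻¹ ⊛ ∑[ k < suc L ] schur k (λ r → q^ (r ℕ.* r))
    ≈⟨ ⊛-cong-≈[] {f = qPoch∞ ⁻¹} (λ _ _ → refl) (seriesℤ≈ L) ⟨
  qPoch∞ ⁻¹ ⊛ seriesℤ ∎) L (ℕ.n<1+n L))
  where open SetoidReasoning (≈[]-setoid (suc L))

corollary5p1 : ∃[ L ] ∃[ P ] ∃[ R ]
    HasSum (λ n → q^ (n ^ℕ 2) ⊛ qPoch (2 *ℕ n) ⁻¹) L
    × (qPoch ⟶ P)
    × HasSumℤ (λ k → q^⟨ + 15 * (k * k) + k , 15k²+k≥0 k ⟩ ⊖ q^⟨ + 15 * (k * k) + + 11 * k + + 2 , 15k²+11k+2≥0 k ⟩) R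
    × (L ≋ P ⁻¹ ⊛ R)
corollary5p1 = series , qPoch∞ , seriesℤ , hasSum , qPoch⟶qPoch∞ , hasSumℤ , series≋
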